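{- Let $m>1$ be an integer that is not a prime power, with prime factorization $m=p_1^{e_1}p_2^{e_2}\cdots p_r^{e_r}$ ($r\ge 2$ distinct primes). There is a constant $c>0$ depending only on $m$ such that for every $n\ge 3$ the following holds. Let $X=\{x_{ij}\}$ be the $n\times n$ matrix whose entries are distinct indeterminates over $\mathbb{Z}_m$. Then there exist effectively computable constant $n\times t$ matrices $B$ and $C$ over $\mathbb{Z}_m$, where $$t\le \exp\Big(c\,\sqrt[r]{\log n\,(\log\log n)^{r-1}}\Big)\quad(\text{in particular } t=n^{o(1)}),$$ such that the $n\times n$ matrix $XBC^T$ is a 1-a-strong representation of the matrix $X$ modulo $m$. Moreover, every column of $XBC^T$ is a linear combination (with coefficients in $\mathbb{Z}_m$) of the columns of $X$.
   Context: $\mathbb{Z}_m$ denotes the ring of integers modulo $m=p_1^{e_1}\cdots p_\ell^{e_\ell}$. For polynomials $f=\sum_I a_I x_I$ and $g=\sum_I b_I x_I$ over $\mathbb{Z}_m$ (sums over monomials $x_I$), $g$ is an alternative representation of $f$ modulo $m$ if for every monomial $I$ there is some $j$ with $a_I\equiv b_I \pmod{p_j^{e_j}}$; $g$ is a 1-a-strong representation of $f$ modulo $m$ if it is an alternative representation and, whenever $a_I\not\equiv b_I\pmod{p_i^{e_i}}$ for some $i$, then $a_I\equiv 0\pmod m$. A matrix $D=\{d_{ij}\}$ whose entries are polynomials in the indeterminates $\{x_{ij}\}$ is a 1-a-strong representation of the matrix $X=\{x_{ij}\}$ modulo $m$ if for all $1\le i,j\le n$ the polynomial $d_{ij}$ is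 a 1-a-strong representation of the polynomial $x_{ij}$ modulo $m$ (equivalently, for linear $d_{ij}$: the coefficient of $x_{ij}$ in $d_{ij}$ is $\equiv 1\pmod m$ and every other coefficient is $\equiv 0$ modulo at least one $p_k^{e_k}$). -}

module Defs where

open import Algebra.Bundles.Raw using (RawSemiring)
import Algebra.Definitions.RawMonoid as RawMonoidDefs
import Algebra.Definitions.RawSemiring as RawSemiringDefs
open import Data.Bool.Base using (if_then_else_)
open import Data.Fin.Base using (Fin; combine)
open import Data.Integer.Base as ℤ using (ℤ)
open import Data.Integer.Divisibility.Signed using () renaming (_∣_ to _∣ᶻ_)
open import Data.List.Base using (List; []; _∷_; _++_; cartesianProductWith)
open import Data.Nat.Base as ℕ using (ℕ; zero; suc)
import Data.Nat.Properties as ℕ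
open import Data.Nat.Primality using (Prime)
open import Data.Product.Base using (∃; ∃-syntax; _×_; _,_)
open import Data.Rational.Base as ℚ using (ℚ; 0ℚ; 1ℚ)
import Data.Rational.Properties as ℚ
open import Data.Vec.Base as Vec using (Vec; replicate; zipWith; _[_]≔_)
import Data.Vec.Properties as Vec
open import Data.Vec.Functional using (Vector)
open import Function.Definitions using (Injective)
open import Level using (0ℓ)
open import Relation.Binary.PropositionalEquality.Core using (_≡_)
open import Relation.Nullary.Decidable.Core using (⌊_⌋)
open import Relation.Nullary.Negation.Core using (¬_)

------------------------------------------------------------------------
-- Integers modulo m

IsPrimePower : ℕ → Set
IsPrimePower m = ∃[ p ] ∃[ k ] Prime p × 1 ℕ.≤ k × m ≡ p ℕ.^ k

-- m = p₁^e₁ ⋯ p_r^e_r with distinct primes pᵢ and positive exponents eᵢ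
record PrimePowerFactorisation (m : ℕ) : Set where
  field
    r              : ℕ
    p              : Fin r → ℕ
    e              : Fin r → ℕ
    prime          : ∀ i → Prime (p i)
    distinct       : Injective _≡_ _≡_ p
    positive       : ∀ i → 1 ℕ.≤ e i

  component : Fin r → ℕ
  component i = p i ℕ.^ e i

  field
    factorisation  : m ≡ RawMonoidDefs.sum ℕ.*-1-rawMonoid component

infix 4 _≅_mod_

_≅_mod_ : ℤ → ℤ → ℕ → Set
a ≅ b mod m = (ℤ.+ m) ∣ᶻ (a ℤ.- b)

-- The ring ℤ_m as a setoid: its elements are represented by integers.
ℤ/ : ℕ → RawSemiring 0ℓ 0ℓ
ℤ/ m = record
  { Carrier = ℤ
  ; _≈_     = λ a b → a ≅ b mod m
  ; _+_     = ℤ._+_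
  ; _*_     = ℤ._*_
  ; 0#      = ℤ.0ℤ
  ; 1#      = ℤ.1ℤ
  }

------------------------------------------------------------------------
-- Matrices

Matrix : ∀ {a} → Set a → ℕ → ℕ → Set a
Matrix A m n = Fin m → Fin n → A

infixl 10 _ᵀ

_ᵀ : ∀ {a} {A : Set a} {m n} → Matrix A m n → Matrix A n m
(M ᵀ) i j = M j i

module _ {c ℓ} (R : RawSemiring c ℓ) where
  open RawSemiring R
  open RawSemiringDefs R using (sum)

  matMul : ∀ {l m n} → Matrix Carrier l m → Matrix Carrier m n → Matrix Carrier l n
  matMul M N i j = sum λ k → M i k * N k j

------------------------------------------------------------------------
-- Polynomials in v indeterminates

-- A monomial is its vector of exponents.
Monomial : ℕ → Set
Monomial v = Vec ℕ v

module Polynomials {c ℓ} (R : RawSemiring c ℓ) where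
  open RawSemiring R

  -- A formal sum of terms, in which a monomial may occur repeatedly;
  -- polynomials are compared through their collected coefficients.
  Polynomial : ℕ → Set c
  Polynomial v = List (Carrier × Monomial v)

  coeff : ∀ {v} → Polynomial v → Monomial v → Carrier
  coeff []            I = 0#
  coeff ((a , J) ∷ f) I =
    if ⌊ Vec.≡-dec ℕ._≟_ J I ⌋ then a + coeff f I else coeff f I

  const : ∀ {v} → Carrier → Polynomial v
  const a = (a , replicate _ 0) ∷ []

  var : ∀ {v} → Fin v → Polynomial v
  var i = (1# , replicate _ 0 [ i ]≔ 1) ∷ []

  _*ᵗ_ : ∀ {v} (s t : Carrier × Monomial v) → Carrier × Monomial v
  (a , I) *ᵗ (b , J) = a * b , zipWith ℕ._+_ I J

  infixl 7 _*ᵖ_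

  _*ᵖ_ : ∀ {v} → Polynomial v → Polynomial v → Polynomial v
  _*ᵖ_ = cartesianProductWith _*ᵗ_

  polynomials : ℕ → RawSemiring c ℓ
  polynomials v = record
    { Carrier = Polynomial v
    ; _≈_     = λ f g → ∀ I → coeff f I ≈ coeff g I
    ; _+_     = _++_
    ; _*_     = _*ᵖ_
    ; 0#      = []
    ; 1#      = const 1#
    }

  -- A constant matrix viewed as a matrix of polynomials.
  constᴹ : ∀ {v m n} → Matrix Carrier m n → Matrix (Polynomial v) m n
  constᴹ M i j = const (M i j)

  -- The matrix of indeterminates x_ij; combine is the bijection
  -- Fin n × Fin n → Fin (n * n).
  indeterminates : ∀ n → Matrix (Polynomial (n ℕ.* n)) n n
  indeterminates n i j = var (combine i j)

  module _ {v m n n′ : ℕ} where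
    open RawSemiring (polynomials v) using () renaming (_≈_ to _≈ᵖ_)
    open RawSemiringDefs (polynomials v) using (sum)

    ColumnsAreCombinationsOf :
      Matrix (Polynomial v) m n′ → Matrix (Polynomial v) m n → Set (c Level.⊔ ℓ)
    ColumnsAreCombinationsOf Y X =
      ∀ j → ∃ λ (a : Vector Carrier n) →
      ∀ i → Y i j ≈ᵖ sum λ k → const (a k) *ᵖ X i k

------------------------------------------------------------------------
-- Representations modulo m

-- Polynomials over ℤ_m enter only through congruences modulo m and its
-- divisors p_i^e_i, so everything below is independent of the choice of
-- integer representatives.
module Representations {m : ℕ} (F : PrimePowerFactorisation m) where
  open PrimePowerFactorisation F
  open Polynomials (ℤ/ m)

  IsAlternativeRep : ∀ {v} → Polynomial v → Polynomial v → Set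
  IsAlternativeRep g f =
    ∀ I → ∃[ j ] coeff f I ≅ coeff g I mod component j

  Is1-a-StrongRep : ∀ {v} → Polynomial v → Polynomial v → Set
  Is1-a-StrongRep g f =
    IsAlternativeRep g f ×
    (∀ I → (∃[ i ] ¬ (coeff f I ≅ coeff g I mod component i)) →
      coeff f I ≅ ℤ.0ℤ mod m)

  Is1-a-StrongMatrixRep : ∀ {v n} →
    Matrix (Polynomial v) n n → Matrix (Polynomial v) n n → Set
  Is1-a-StrongMatrixRep D X = ∀ i j → Is1-a-StrongRep (D i j) (X i j)

------------------------------------------------------------------------
-- Real numbers as lower Dedekind cuts

-- q ∈ x means q < x. The empty cut is -∞ and the full cut is +∞.
record Real : Set₁ where
  field
    cut     : ℚ → Set
    closed  : ∀ {q q′} → q ℚ.< q′ → cut q′ → cut q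
    rounded : ∀ {q} → cut q → ∃[ q′ ] q ℚ.< q′ × cut q′

infix 4 _∈_ _≤ᴿ_

_∈_ : ℚ → Real → Set
q ∈ x = Real.cut x q

_≤ᴿ_ : Real → Real → Set
x ≤ᴿ y = ∀ q → q ∈ x → q ∈ y

-- The supremum of a set of rationals.
sup : (ℚ → Set) → Real
sup P = record
  { cut     = λ q → ∃[ s ] P s × q ℚ.< s
  ; closed  = λ { q<q′ (s , Ps , q′<s) → s , Ps , ℚ.<-trans q<q′ q′<s }
  ; rounded = λ { (s , Ps , q<s) → let (q′ , q<q′ , q′<s) = ℚ.<-dense q<s in
                  q′ , q<q′ , s , Ps , q′<s }
  }

fromℚ : ℚ → Real
fromℚ a = sup (_≡ a)

fromℕ : ℕ → Real
fromℕ n = fromℚ (ℤ.+ n ℚ./ 1)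

infixr 8 _^ℚ_

_^ℚ_ : ℚ → ℕ → ℚ
_^ℚ_ = RawSemiringDefs._^_ ℚ.+-*-rawSemiring

-- Multiplication, powers, roots and logarithms have their usual meaning on
-- strictly positive reals, to which their use below is confined; exp has it on
-- all reals.

infixl 7 _*ᴿ_
infixr 8 _^ᴿ_

_*ᴿ_ : Real → Real → Real
x *ᴿ y = sup λ s →
  ∃[ a ] ∃[ b ] a ∈ x × b ∈ y × 0ℚ ℚ.≤ a × 0ℚ ℚ.≤ b × s ≡ a ℚ.* b

_^ᴿ_ : Real → ℕ → Real
x ^ᴿ zero  = fromℚ 1ℚ
x ^ᴿ suc k = x *ᴿ x ^ᴿ k

root : ℕ → Real → Real
root k x = sup λ s → 0ℚ ℚ.≤ s × (s ^ℚ k) ∈ x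

-- (1 + q/N)^N increases to exp q as N ranges over the N with 1 + q/N ≥ 0.
exp : Real → Real
exp x = sup λ s → ∃[ q ] q ∈ x × ∃[ k ]
  let b = 1ℚ ℚ.+ q ℚ.* (ℤ.1ℤ ℚ./ suc k) in
  0ℚ ℚ.≤ b × s ≡ b ^ℚ suc k

-- log x is the supremum of the rationals s with exp s < x.
log : Real → Real
log x = sup λ s → ∃[ q ] q ∈ x × exp (fromℚ s) ≤ᴿ fromℚ q

------------------------------------------------------------------------
-- Growth of the inner dimension

-- exp (c · (log n · (log log n)^(r-1))^(1/r)), where n ≥ 3 makes log log n > 0
sizeBound : ℚ → ℕ → ℕ → Real
sizeBound c r n =
  exp (fromℚ c *ᴿ root r (log x *ᴿ log (log x) ^ᴿ (r ℕ.∸ 1)))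
  where x = fromℕ n

-- t(n) = n^o(1): for every k ≥ 1, eventually n^(-1/k) ≤ t(n) ≤ n^(1/k).
IsSubpolynomial : (ℕ → ℕ) → Set
IsSubpolynomial t = ∀ k → 1 ℕ.≤ k → ∃[ n₀ ] ∀ n → n₀ ℕ.≤ n →
  t n ℕ.^ k ℕ.≤ n × 1 ℕ.≤ n ℕ.* t n ℕ.^ k

{-# OPTIONS --safe #-}

-- Index the rows by words of length h over an alphabet of size k, with k^h ≥ n,
-- and let w be the Hamming distance of two words. The matrix C(w − 1, P − 1) has
-- rank at most (hk + 1)^(P − 1), by Pascal's rule applied letter by letter. Since
-- w C(w − 1, P − 1) = P C(w, P), for P = p^(x+e) this entry is 0 modulo p^e unless
-- p^(x+1) divides w, and at w = 0 it is ±1. Choose for each prime pᵢ of m the x with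
-- pᵢ^x ≤ s + 1 < pᵢ^(x+1). The product of the r numbers pᵢ^(x+1) exceeds
-- h = (s + 1)^r ≥ w, so they cannot all divide a w ≠ 0, and the Chinese remainder
-- theorem combines the r matrices into BCᵀ. With s ≈ (log n / log log n)^(1/r) and
-- log k ≈ log log n, the rank is exp (O (s log log n)).
module Submission where

open import Defs
import Algebra.Definitions.RawMonoid as RawMonoidDefs
import Algebra.Definitions.RawSemiring as RawSemiringDefs
import Algebra.Properties.CommutativeSemiring.Exp as Exp
import Algebra.Properties.Semiring.Sum as Sum
open import Algebra.Bundles using (CommutativeRing)
open import Data.Bool.Base using (true; false)
open import Data.Fin.Base using (Fin; zero; suc; combine; finToFun; fromℕ<; funToFin; inject≤)
import Data.Fin.Properties as Fin
open import Data.Integer.Base as ℤ using (ℤ)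
import Data.Integer.Divisibility.Signed as ℤ∣
import Data.Integer.Properties as ℤ
open import Data.Integer.Solver using () renaming (module +-*-Solver to ℤ-Solver)
open import Data.List.Base using (List; []; _∷_; _++_; length; map)
import Data.List.Properties as List
open import Data.Nat.Base as ℕ using (ℕ; zero; suc; _≤_; _<_; _∸_; z≤n; s≤s; NonZero)
import Data.Nat.Combinatorics as Combinatorics
open import Data.Nat.Coprimality as Coprimality using (Coprime; coprime-divisor; coprime-Bézout)
open import Data.Nat.Divisibility as ℕ∣ using (_∣_; divides)
open import Data.Nat.GCD using (module Bézout)
open import Data.Nat.Primality using (Prime; ¬prime[1]; prime⇒irreducible; prime⇒nonTrivial; prime⇒nonZero)
import Data.Nat.Properties as ℕ
open import Data.Nat.Solver using () renaming (module +-*-Solver to ℕ-Solver)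
open import Data.Product.Base as Product using (Σ-syntax; ∃-syntax; _×_; _,_; proj₁; proj₂)
open import Data.Rational.Base as ℚ using (ℚ; 0ℚ; 1ℚ; ½; fromℚᵘ)
import Data.Rational.Properties as ℚ
open import Data.Rational.Solver using () renaming (module +-*-Solver to ℚ-Solver)
open import Data.Rational.Unnormalised.Base as ℚᵘ using (mkℚᵘ)
import Data.Rational.Unnormalised.Properties as ℚᵘ
open import Data.Sum.Base using (inj₁; inj₂)
open import Data.Vec.Base as Vec using (lookup; replicate; _[_]≔_)
import Data.Vec.Properties as Vec
open import Function.Base using (_∘_; case_of_)
open import Relation.Binary.PropositionalEquality
open import Relation.Nullary.Decidable.Core using (yes; no; ⌊_⌋; from-yes)
open import Relation.Nullary.Negation.Core using (¬_; contradiction)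

open Exp (CommutativeRing.commutativeSemiring ℚ.+-*-commutativeRing) using (^-distrib-*; ^-assocʳ)
open RawMonoidDefs ℕ.*-1-rawMonoid using () renaming (sum to product)
open Sum ℤ.+-*-semiring using (sum; sum-cong-≗; ∑-comm; *-distribˡ-sum; *-distribʳ-sum; sum-replicate-zero)

-- Sums and congruences of integers

-- Entry (i, j) of X B Cᵀ is ∑ₗ (B Cᵀ)ₗⱼ xᵢₗ, so everything rests on a constant matrix B Cᵀ that is
-- 1 modulo m on the diagonal and vanishes modulo some pᵢ^eᵢ at each place off it. The large
-- alphabet is what produces the exponent r - 1 of log log n. Binary words would need h ≈ log n and
-- give rank exp (O ((log n)^(1/r) log log n)); about log n symbols shorten the words by a factor
-- log log n and s by its r-th root, while hk + 1 stays polylogarithmic in n. Solving the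
-- congruences separately in every entry would lose control of the rank. Fixed coefficients, the
-- idempotents of the Chinese remainder theorem, make the combination linear, so that ranks add.
-- Reals are lower cuts, so the size bound only asks for rationals below log n and log log n. The
-- estimates are crude on purpose: each strict inequality of a cut needs slack, and c absorbs it.

sum-0 : ∀ {n} (f : Fin n → ℤ) → (∀ i → f i ≡ ℤ.0ℤ) → sum f ≡ ℤ.0ℤ
sum-0 {n} f f≗0 = trans (sum-cong-≗ f≗0) (sum-replicate-zero n)

sum-single : ∀ {n} (f : Fin n → ℤ) i → (∀ j → j ≢ i → f j ≡ ℤ.0ℤ) → sum f ≡ f i
sum-single f zero    f≢i≡0 =
  trans (cong (λ x → f zero ℤ.+ x) (sum-0 _ λ j → f≢i≡0 (suc j) λ ())) (ℤ.+-identityʳ (f zero))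
sum-single f (suc i) f≢i≡0 =
  trans (cong₂ ℤ._+_ (f≢i≡0 zero λ ()) (sum-single (f ∘ suc) i λ j j≢i → f≢i≡0 (suc j) (j≢i ∘ Fin.suc-injective)))
  (ℤ.+-identityˡ (f (suc i)))

mod-reflexive : ∀ {m a b} → a ≡ b → a ≅ b mod m
mod-reflexive {m} {a} refl = subst (ℤ.+ m ℤ∣.∣_) (sym (ℤ.+-inverseʳ a)) (ℤ∣.divides ℤ.0ℤ refl)

mod-sym : ∀ {m a b} → a ≅ b mod m → b ≅ a mod m
mod-sym {m} {a} {b} a≅b =
  subst (ℤ.+ m ℤ∣.∣_) (solve 2 (λ a b → :- (a :- b) := b :- a) refl a b) (ℤ∣.∣m⇒∣-m a≅b)
  where open ℤ-Solver

mod-trans : ∀ {m a b c} → a ≅ b mod m → b ≅ c mod m → a ≅ c mod m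
mod-trans {m} {a} {b} {c} a≅b b≅c =
  subst (ℤ.+ m ℤ∣.∣_) (solve 3 (λ a b c → (a :- b) :+ (b :- c) := a :- c) refl a b c) (ℤ∣.∣m∣n⇒∣m+n a≅b b≅c)
  where open ℤ-Solver

mod-*ʳ : ∀ {m a b} c → a ≅ b mod m → a ℤ.* c ≅ b ℤ.* c mod m
mod-*ʳ {m} {a} {b} c a≅b =
  subst (ℤ.+ m ℤ∣.∣_) (solve 3 (λ a b c → (a :- b) :* c := a :* c :- b :* c) refl a b c) (ℤ∣.∣m⇒∣m*n c a≅b)
  where open ℤ-Solver

mod-sum : ∀ {m r} (f f′ : Fin r → ℤ) → (∀ i → f i ≅ f′ i mod m) → sum f ≅ sum f′ mod m
mod-sum {m} {zero}  f f′ f≅f′ = mod-reflexive {m} {ℤ.0ℤ} refl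
mod-sum {m} {suc r} f f′ f≅f′ = subst (ℤ.+ m ℤ∣.∣_)
  (solve 4 (λ a b c d → (a :- b) :+ (c :- d) := (a :+ c) :- (b :+ d)) refl (f zero) (f′ zero) (sum (f ∘ suc)) (sum (f′ ∘ suc)))
  (ℤ∣.∣m∣n⇒∣m+n (f≅f′ zero) (mod-sum (f ∘ suc) (f′ ∘ suc) (f≅f′ ∘ suc)))
  where open ℤ-Solver

-- Shifted binomial coefficients

module _ where
  open Combinatorics using (_C_; nC1≡n; nCk+nC[k+1]≡[n+1]C[k+1]; k>n⇒nCk≡0)

  absorption : ∀ n k → suc n ℕ.* (n C k) ≡ suc k ℕ.* (suc n C suc k)
  absorption n       zero    = trans (ℕ.*-comm (suc n) 1) (cong (1 ℕ.*_) (sym (nC1≡n (suc n))))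
  absorption zero    (suc k) = trans (cong (1 ℕ.*_) (k>n⇒nCk≡0 {0} {suc k} (ℕ.s≤s ℕ.z≤n)))
    (sym (trans (cong (suc (suc k) ℕ.*_) (k>n⇒nCk≡0 {1} {suc (suc k)} (ℕ.s≤s (ℕ.s≤s ℕ.z≤n)))) (ℕ.*-zeroʳ (suc (suc k)))))
  absorption (suc n) (suc k) = begin
    suc (suc n) ℕ.* c                            ≡⟨⟩
    c ℕ.+ suc n ℕ.* c
      ≡⟨ cong (λ x → c ℕ.+ suc n ℕ.* x) (nCk+nC[k+1]≡[n+1]C[k+1] n k) ⟨
    c ℕ.+ suc n ℕ.* (n C k ℕ.+ n C suc k)
      ≡⟨ cong (λ x → c ℕ.+ x) (ℕ.*-distribˡ-+ (suc n) (n C k) (n C suc k)) ⟩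
    c ℕ.+ (suc n ℕ.* (n C k) ℕ.+ suc n ℕ.* (n C suc k))
      ≡⟨ cong₂ (λ x y → c ℕ.+ (x ℕ.+ y)) (absorption n k) (absorption n (suc k)) ⟩
    c ℕ.+ (suc k ℕ.* c ℕ.+ suc (suc k) ℕ.* d)    ≡⟨ ℕ.+-assoc c (suc k ℕ.* c) (suc (suc k) ℕ.* d) ⟨
    suc (suc k) ℕ.* c ℕ.+ suc (suc k) ℕ.* d      ≡⟨ ℕ.*-distribˡ-+ (suc (suc k)) c d ⟨
    suc (suc k) ℕ.* (c ℕ.+ d)
      ≡⟨ cong (suc (suc k) ℕ.*_) (nCk+nC[k+1]≡[n+1]C[k+1] (suc n) (suc k)) ⟩
    suc (suc k) ℕ.* (suc (suc n) C suc (suc k))  ∎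
    where
    open ≡-Reasoning
    c = suc n C suc k
    d = suc n C suc (suc k)

  -- g d w is the binomial coefficient C(w − 1, d), where C(−1, d) = (−1)^d.
  g : ℕ → ℕ → ℤ
  g zero    w       = ℤ.1ℤ
  g (suc d) zero    = ℤ.- g d zero
  g (suc d) (suc w) = g (suc d) w ℤ.+ g d w

  -- The clause `- g d zero` extends Pascal's rule one step to the left: it is the value at -1 that
  -- makes C(0, d + 1) vanish.
  g-suc : ∀ d w → g d (suc w) ≡ ℤ.+ (w C d)
  g-suc zero    w       = refl
  g-suc (suc d) zero    =
    trans (ℤ.+-inverseˡ (g d zero)) (cong ℤ.+_ (sym (k>n⇒nCk≡0 {0} {suc d} (ℕ.s≤s ℕ.z≤n))))
  g-suc (suc d) (suc w) = trans (cong₂ ℤ._+_ (g-suc (suc d) w) (g-suc d w))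
    (cong ℤ.+_ (trans (ℕ.+-comm (w C suc d) (w C d)) (nCk+nC[k+1]≡[n+1]C[k+1] w d)))

  -- Multiplying by the sign `g d 0` therefore turns the diagonal value ±1 into exactly 1.
  g-zero² : ∀ d → g d 0 ℤ.* g d 0 ≡ ℤ.1ℤ
  g-zero² zero    = refl
  g-zero² (suc d) =
    trans (solve 1 (λ x → (:- x) :* (:- x) := x :* x) refl (g d 0)) (g-zero² d)
    where open ℤ-Solver

-- Prime powers and the Chinese remainder theorem

coprime-*ˡ : ∀ {a b n} → Coprime a n → Coprime b n → Coprime (a ℕ.* b) n
coprime-*ˡ a⊥n b⊥n (d∣ab , d∣n) =
  b⊥n (coprime-divisor (λ (e∣d , e∣a) → a⊥n (e∣a , ℕ∣.∣-trans e∣d d∣n)) d∣ab , d∣n)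

coprime-^ˡ : ∀ {a n} k → Coprime a n → Coprime (a ℕ.^ k) n
coprime-^ˡ zero    a⊥n = Coprimality.1-coprimeTo _
coprime-^ˡ (suc k) a⊥n = coprime-*ˡ a⊥n (coprime-^ˡ k a⊥n)

prime-∤⇒coprime : ∀ {p n} → Prime p → ¬ p ∣ n → Coprime p n
prime-∤⇒coprime pr p∤n (d∣p , d∣n) with prime⇒irreducible pr d∣p
... | inj₁ d≡1  = d≡1
... | inj₂ refl = contradiction d∣n p∤n

distinct-primes⇒coprime : ∀ {p q} → Prime p → Prime q → p ≢ q → Coprime p q
distinct-primes⇒coprime pp pq p≢q = prime-∤⇒coprime pp λ p∣q → case prime⇒irreducible pq p∣q of λ where
  (inj₁ refl) → ¬prime[1] pp
  (inj₂ p≡q)  → p≢q p≡q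

-- At most x of the x + e factors p can go into w. Induction on x strips them from w one by one;
-- once p no longer divides w, the whole remaining power is coprime to w and divides y.
p^e∣ : ∀ {p} → Prime p → ∀ x e w y → p ℕ.^ (x ℕ.+ e) ∣ w ℕ.* y → ¬ p ℕ.^ suc x ∣ w → p ℕ.^ e ∣ y
p^e∣ {p} pr zero    e w y p^e∣wy p∤w =
  coprime-divisor (coprime-^ˡ e (prime-∤⇒coprime pr λ p∣w → p∤w (subst (_∣ w) (sym (ℕ.*-identityʳ p)) p∣w))) p^e∣wy
p^e∣ {p} pr (suc x) e w y p^x+e∣wy p^x∤w with p ℕ∣.∣? w
... | no  p∤w =
  ℕ∣.∣-trans (ℕ∣.divides (p ℕ.^ suc x) (ℕ.^-distribˡ-+-* p (suc x) e)) (coprime-divisor (coprime-^ˡ (suc x ℕ.+ e) (prime-∤⇒coprime pr p∤w)) p^x+e∣wy)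
... | yes (divides w′ refl) = p^e∣ pr x e w′ y
  (ℕ∣.*-cancelˡ-∣ p (subst (p ℕ.^ suc (x ℕ.+ e) ∣_) (regroup w′ p y) p^x+e∣wy))
  (λ p^x∣w′ → p^x∤w (subst (p ℕ.^ suc (suc x) ∣_) (ℕ.*-comm p w′) (ℕ∣.*-monoʳ-∣ p p^x∣w′)))
  where
  instance _ = prime⇒nonZero pr
  regroup : ∀ w p y → w ℕ.* p ℕ.* y ≡ p ℕ.* (w ℕ.* y)
  regroup = solve 3 (λ w p y → w :* p :* y := p :* (w :* y)) refl where open ℕ-Solver

module _ where
  open Combinatorics using (_C_)

  -- Distance 0, where the value is ±1, is ruled out because every power divides 0. For positive
  -- distance `absorption` puts the factor p^(x+e) = `suc d` into the product to which `p^e∣`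
  -- applies.
  p^e∣g : ∀ {p} → Prime p → ∀ x e d w → suc d ≡ p ℕ.^ (x ℕ.+ e) → ¬ p ℕ.^ suc x ∣ w → ℤ.+ (p ℕ.^ e) ℤ∣.∣ g d w
  p^e∣g {p} pr x e d zero    1+d≡P p^x∤0 = contradiction (ℕ∣._∣0 (p ℕ.^ suc x)) p^x∤0
  p^e∣g {p} pr x e d (suc w) 1+d≡P p^x∤w = subst (ℤ.+ (p ℕ.^ e) ℤ∣.∣_) (sym (g-suc d w)) (ℤ∣.∣ᵤ⇒∣
    (p^e∣ pr x e (suc w) (w C d) (subst₂ _∣_ 1+d≡P (sym (absorption w d)) (ℕ∣.m∣m*n (suc w C suc d))) p^x∤w))

PairwiseCoprime : ∀ {r} → (Fin r → ℕ) → Set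
PairwiseCoprime q = ∀ i j → i ≢ j → Coprime (q i) (q j)

coprime-product : ∀ {r n} (q : Fin r → ℕ) → (∀ i → Coprime (q i) n) → Coprime (product q) n
coprime-product {zero}  q q⊥n = Coprimality.1-coprimeTo _
coprime-product {suc r} q q⊥n = coprime-*ˡ (q⊥n zero) (coprime-product (q ∘ suc) (q⊥n ∘ suc))

head-⊥-tail : ∀ {r} (q : Fin (suc r) → ℕ) → PairwiseCoprime q → Coprime (product (q ∘ suc)) (q zero)
head-⊥-tail q q⊥ = coprime-product (q ∘ suc) λ i → q⊥ (suc i) zero λ ()

tail-⊥ : ∀ {r} (q : Fin (suc r) → ℕ) → PairwiseCoprime q → PairwiseCoprime (q ∘ suc)
tail-⊥ q q⊥ i j i≢j = q⊥ (suc i) (suc j) (i≢j ∘ Fin.suc-injective)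

product-∣ : ∀ {r n} (q : Fin r → ℕ) → PairwiseCoprime q → (∀ i → q i ∣ n) → product q ∣ n
product-∣ {zero}  {n} q q⊥ q∣n = ℕ∣.1∣ n
product-∣ {suc r} {n} q q⊥ q∣n with q∣n zero
... | divides c refl = subst (_∣ c ℕ.* q zero) (ℕ.*-comm (product (q ∘ suc)) (q zero))
  (ℕ∣.*-monoˡ-∣ (q zero) (coprime-divisor (head-⊥-tail q q⊥)
    (subst (product (q ∘ suc) ∣_) (ℕ.*-comm c (q zero)) (product-∣ (q ∘ suc) (tail-⊥ q q⊥) (q∣n ∘ suc)))))

∣-product : ∀ {r} (q : Fin r → ℕ) i → q i ∣ product q
∣-product q zero    = ℕ∣.m∣m*n (product (q ∘ suc))
∣-product q (suc i) = ℕ∣.∣n⇒∣m*n (q zero) (∣-product (q ∘ suc) i)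

inverse-mod : ∀ {a n} → Coprime a n → ∃[ y ] y ℤ.* ℤ.+ a ≅ ℤ.1ℤ mod n
inverse-mod {a} {n} a⊥n with coprime-Bézout a⊥n
... | Bézout.+- x y 1+yn≡xa = ℤ.+ x , ℤ∣.divides (ℤ.+ y) (begin
  ℤ.+ x ℤ.* ℤ.+ a ℤ.- ℤ.1ℤ              ≡⟨ cong (ℤ._- ℤ.1ℤ) (ℤ.pos-* x a) ⟨
  ℤ.+ (x ℕ.* a) ℤ.- ℤ.1ℤ                ≡⟨ cong (λ z → ℤ.+ z ℤ.- ℤ.1ℤ) 1+yn≡xa ⟨
  (ℤ.1ℤ ℤ.+ ℤ.+ (y ℕ.* n)) ℤ.- ℤ.1ℤ     ≡⟨ solve 1 (λ z → (con ℤ.1ℤ :+ z) :- con ℤ.1ℤ := z) refl (ℤ.+ (y ℕ.* n)) ⟩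
  ℤ.+ (y ℕ.* n)                         ≡⟨ ℤ.pos-* y n ⟩
  ℤ.+ y ℤ.* ℤ.+ n                       ∎)
  where open ≡-Reasoning; open ℤ-Solver
... | Bézout.-+ x y 1+xa≡yn = ℤ.- ℤ.+ x , ℤ∣.divides (ℤ.- ℤ.+ y) (begin
  ℤ.- ℤ.+ x ℤ.* ℤ.+ a ℤ.- ℤ.1ℤ
    ≡⟨ solve 2 (λ x a → (:- x) :* a :- con ℤ.1ℤ := :- (con ℤ.1ℤ :+ x :* a)) refl (ℤ.+ x) (ℤ.+ a) ⟩
  ℤ.- (ℤ.1ℤ ℤ.+ ℤ.+ x ℤ.* ℤ.+ a)        ≡⟨ cong (λ z → ℤ.- (ℤ.1ℤ ℤ.+ z)) (ℤ.pos-* x a) ⟨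
  ℤ.- ℤ.+ (1 ℕ.+ x ℕ.* a)               ≡⟨ cong (λ z → ℤ.- ℤ.+ z) 1+xa≡yn ⟩
  ℤ.- ℤ.+ (y ℕ.* n)                     ≡⟨ cong ℤ.-_ (ℤ.pos-* y n) ⟩
  ℤ.- (ℤ.+ y ℤ.* ℤ.+ n)                 ≡⟨ ℤ.neg-distribˡ-* (ℤ.+ y) (ℤ.+ n) ⟩
  ℤ.- ℤ.+ y ℤ.* ℤ.+ n                   ∎)
  where open ≡-Reasoning; open ℤ-Solver

crt : ∀ {r} (q : Fin r → ℕ) → PairwiseCoprime q → (x : Fin r → ℤ) → ∃[ z ] ∀ i → z ≅ x i mod q i
crt {zero}  q q⊥ x = ℤ.0ℤ , λ ()
crt {suc r} q q⊥ x with crt (q ∘ suc) (tail-⊥ q q⊥) (x ∘ suc) | inverse-mod (head-⊥-tail q q⊥)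
-- The correction is a multiple of Q, hence invisible to the tail moduli; modulo `q zero` the
-- product y Q is 1, so the correction replaces z by `x zero`.
... | z , z≅x | y , yQ≅1 = z ℤ.+ y ℤ.* Q ℤ.* (x zero ℤ.- z) , λ where
    zero    → subst (ℤ.+ q zero ℤ∣.∣_) (sym (head-eq z y Q (x zero))) (ℤ∣.∣m⇒∣m*n (x zero ℤ.- z) yQ≅1)
    (suc i) → subst (ℤ.+ q (suc i) ℤ∣.∣_) (sym (tail-eq z (y ℤ.* Q ℤ.* (x zero ℤ.- z)) (x (suc i))))
      (ℤ∣.∣m∣n⇒∣m+n (z≅x i) (ℤ∣.∣m⇒∣m*n (x zero ℤ.- z) (ℤ∣.∣n⇒∣m*n y (ℤ∣.∣ᵤ⇒∣ (∣-product (q ∘ suc) i)))))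
  where
  Q = ℤ.+ product (q ∘ suc)
  head-eq : ∀ z y Q x → z ℤ.+ y ℤ.* Q ℤ.* (x ℤ.- z) ℤ.- x ≡ (y ℤ.* Q ℤ.- ℤ.1ℤ) ℤ.* (x ℤ.- z)
  head-eq =
    solve 4 (λ z y Q x → z :+ y :* Q :* (x :- z) :- x := (y :* Q :- con ℤ.1ℤ) :* (x :- z)) refl
    where open ℤ-Solver
  tail-eq : ∀ z u x → z ℤ.+ u ℤ.- x ≡ z ℤ.- x ℤ.+ u
  tail-eq = solve 3 (λ z u x → z :+ u :- x := z :- x :+ u) refl where open ℤ-Solver

δ : ∀ {r} → Fin r → Fin r → ℤ
δ i j with i Fin.≟ j
... | yes _ = ℤ.1ℤ
... | no  _ = ℤ.0ℤ

δ-≡ : ∀ {r} (i : Fin r) → δ i i ≡ ℤ.1ℤ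
δ-≡ i with i Fin.≟ i
... | yes _  = refl
... | no i≢i = contradiction refl i≢i

δ-≢ : ∀ {r} {i j : Fin r} → i ≢ j → δ i j ≡ ℤ.0ℤ
δ-≢ {i = i} {j} i≢j with i Fin.≟ j
... | yes i≡j = contradiction i≡j i≢j
... | no  _   = refl

module _ {r} (q : Fin r → ℕ) (q⊥ : PairwiseCoprime q) where
  -- These coefficients do not depend on the residues to be combined, so matrices can be glued by
  -- one linear combination and the ranks add up.
  idempotent : Fin r → ℤ
  idempotent i = proj₁ (crt q q⊥ (δ i))

  sum-idempotent : ∀ (f : Fin r → ℤ) j → (sum λ i → idempotent i ℤ.* f i) ≅ f j mod q j
  sum-idempotent f j = mod-trans {a = sum λ i → idempotent i ℤ.* f i} {sum λ i → δ i j ℤ.* f i} {f j}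
    (mod-sum (λ i → idempotent i ℤ.* f i) (λ i → δ i j ℤ.* f i) (λ i → mod-*ʳ {a = idempotent i} (f i) (proj₂ (crt q q⊥ (δ i)) j)))
    (mod-reflexive (trans (sum-single (λ i → δ i j ℤ.* f i) j (λ i i≢j → trans (cong (ℤ._* f i) (δ-≢ i≢j)) (ℤ.*-zeroˡ (f i))))
      (trans (cong (ℤ._* f j) (δ-≡ j)) (ℤ.*-identityˡ (f j)))))

-- Low-rank matrices indexed by words

-- A list of rank-one matrices b ⊗ c, standing for their sum.
Terms : Set → Set
Terms X = List ((X → ℤ) × (X → ℤ))

eval : ∀ {X} → Terms X → X → X → ℤ
eval []             u v = ℤ.0ℤ
eval ((b , c) ∷ fs) u v = b u ℤ.* c v ℤ.+ eval fs u v

eval-++ : ∀ {X} (fs gs : Terms X) u v → eval (fs ++ gs) u v ≡ eval fs u v ℤ.+ eval gs u v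
eval-++ []             gs u v = sym (ℤ.+-identityˡ (eval gs u v))
eval-++ ((b , c) ∷ fs) gs u v =
  trans (cong (λ x → b u ℤ.* c v ℤ.+ x) (eval-++ fs gs u v)) (sym (ℤ.+-assoc (b u ℤ.* c v) (eval fs u v) (eval gs u v)))

scale : ∀ {X} → ℤ → Terms X → Terms X
scale x = map (Product.map₁ λ b u → x ℤ.* b u)

eval-scale : ∀ {X} x (fs : Terms X) u v → eval (scale x fs) u v ≡ x ℤ.* eval fs u v
eval-scale x []             u v = sym (ℤ.*-zeroʳ x)
eval-scale x ((b , c) ∷ fs) u v =
  trans (cong₂ ℤ._+_ (ℤ.*-assoc x (b u) (c v)) (eval-scale x fs u v)) (sym (ℤ.*-distribˡ-+ x (b u ℤ.* c v) (eval fs u v)))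

pull : ∀ {X Y : Set} → (X → Y) → Terms Y → Terms X
pull f = map (Product.map (_∘ f) (_∘ f))

eval-pull : ∀ {X Y : Set} (f : X → Y) fs u v → eval (pull f fs) u v ≡ eval fs (f u) (f v)
eval-pull f []             u v = refl
eval-pull f ((b , c) ∷ fs) u v = cong (λ x → b (f u) ℤ.* c (f v) ℤ.+ x) (eval-pull f fs u v)

infixl 7 _⊙_

-- The Hadamard product: the entrywise product of two rank-one matrices again has rank one, so the
-- numbers of terms multiply.
_⊙_ : ∀ {X} → Terms X → Terms X → Terms X
[]             ⊙ gs = []
((b , c) ∷ fs) ⊙ gs = map (λ (b′ , c′) → (λ u → b u ℤ.* b′ u) , (λ v → c v ℤ.* c′ v)) gs ++ fs ⊙ gs

eval-⊙ : ∀ {X} (fs gs : Terms X) u v → eval (fs ⊙ gs) u v ≡ eval fs u v ℤ.* eval gs u v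
eval-⊙ []             gs u v = sym (ℤ.*-zeroˡ (eval gs u v))
eval-⊙ ((b , c) ∷ fs) gs u v = trans (eval-++ (map _ gs) (fs ⊙ gs) u v)
  (trans (cong₂ ℤ._+_ (row gs) (eval-⊙ fs gs u v)) (sym (ℤ.*-distribʳ-+ (eval gs u v) (b u ℤ.* c v) (eval fs u v))))
  where
  open ℤ-Solver
  row : ∀ gs → eval (map (λ (b′ , c′) → (λ u → b u ℤ.* b′ u) , (λ v → c v ℤ.* c′ v)) gs) u v ≡ b u ℤ.* c v ℤ.* eval gs u v
  row []               = sym (ℤ.*-zeroʳ (b u ℤ.* c v))
  row ((b′ , c′) ∷ gs) = trans (cong (λ x → b u ℤ.* b′ u ℤ.* (c v ℤ.* c′ v) ℤ.+ x) (row gs))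
    (solve 5 (λ b c b′ c′ e → b :* b′ :* (c :* c′) :+ b :* c :* e := b :* c :* (b′ :* c′ :+ e)) refl (b u) (c v) (b′ u) (c′ v) (eval gs u v))

length-⊙ : ∀ {X} (fs gs : Terms X) → length (fs ⊙ gs) ≡ length fs ℕ.* length gs
length-⊙ []       gs = refl
length-⊙ (_ ∷ fs) gs = trans (List.length-++ (map _ gs)) (cong₂ ℕ._+_ (List.length-map _ gs) (length-⊙ fs gs))

∑ᵀ : ∀ {X r} → (Fin r → Terms X) → Terms X
∑ᵀ {r = zero}  F = []
∑ᵀ {r = suc r} F = F zero ++ ∑ᵀ (F ∘ suc)

eval-∑ᵀ : ∀ {X r} (F : Fin r → Terms X) u v → eval (∑ᵀ F) u v ≡ sum λ i → eval (F i) u v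
eval-∑ᵀ {r = zero}  F u v = refl
eval-∑ᵀ {r = suc r} F u v =
  trans (eval-++ (F zero) (∑ᵀ (F ∘ suc)) u v) (cong (λ x → eval (F zero) u v ℤ.+ x) (eval-∑ᵀ (F ∘ suc) u v))

length-∑ᵀ : ∀ {X r s} (F : Fin r → Terms X) → (∀ i → length (F i) ℕ.≤ s) → length (∑ᵀ F) ℕ.≤ r ℕ.* s
length-∑ᵀ {r = zero}  F ≤s = z≤n
length-∑ᵀ {r = suc r} F ≤s =
  subst (ℕ._≤ _) (sym (List.length-++ (F zero))) (ℕ.+-mono-≤ (≤s zero) (length-∑ᵀ (F ∘ suc) (≤s ∘ suc)))

-- The number t of columns is prescribed by a formula that only bounds the number of terms; the
-- surplus columns are filled with zeros.
factor : ∀ {X} → Terms X → ∀ t → Fin t → (X → ℤ) × (X → ℤ)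
factor []       t       k       = (λ _ → ℤ.0ℤ) , (λ _ → ℤ.0ℤ)
factor (f ∷ fs) (suc t) zero    = f
factor (f ∷ fs) (suc t) (suc k) = factor fs t k

sum-factor : ∀ {X} (fs : Terms X) t → length fs ℕ.≤ t → ∀ u v →
  (sum λ k → proj₁ (factor fs t k) u ℤ.* proj₂ (factor fs t k) v) ≡ eval fs u v
sum-factor []             t       _        u v = sum-0 {t} _ λ _ → refl
sum-factor ((b , c) ∷ fs) (suc t) (s≤s ≤t) u v = cong (λ x → b u ℤ.* c v ℤ.+ x) (sum-factor fs t ≤t u v)

module _ {k : ℕ} where

  Word : ℕ → Set
  Word h = Fin h → Fin k

  [_≠_] : Fin k → Fin k → ℕ
  [ a ≠ b ] with a Fin.≟ b
  ... | yes _ = 0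
  ... | no  _ = 1

  [a≠a]≡0 : ∀ a → [ a ≠ a ] ≡ 0
  [a≠a]≡0 a with a Fin.≟ a
  ... | yes _  = refl
  ... | no a≢a = contradiction refl a≢a

  [a≠b]≡0⇒a≡b : ∀ {a b} → [ a ≠ b ] ≡ 0 → a ≡ b
  [a≠b]≡0⇒a≡b {a} {b} eq with a Fin.≟ b
  ... | yes a≡b = a≡b

  [≠]≤1 : ∀ a b → [ a ≠ b ] ℕ.≤ 1
  [≠]≤1 a b with a Fin.≟ b
  ... | yes _ = z≤n
  ... | no  _ = s≤s z≤n

  dist : ∀ {h} → Word h → Word h → ℕ
  dist {zero}  u v = 0
  dist {suc h} u v = [ u zero ≠ v zero ] ℕ.+ dist (u ∘ suc) (v ∘ suc)

  dist≤ : ∀ {h} (u v : Word h) → dist u v ℕ.≤ h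
  dist≤ {zero}  u v = z≤n
  dist≤ {suc h} u v = ℕ.+-mono-≤ ([≠]≤1 (u zero) (v zero)) (dist≤ (u ∘ suc) (v ∘ suc))

  dist-refl : ∀ {h} (u : Word h) → dist u u ≡ 0
  dist-refl {zero}  u = refl
  dist-refl {suc h} u = cong₂ ℕ._+_ ([a≠a]≡0 (u zero)) (dist-refl (u ∘ suc))

  dist≡0⇒≗ : ∀ {h} {u v : Word h} → dist u v ≡ 0 → u ≗ v
  dist≡0⇒≗ {suc h} {u} {v} eq zero    = [a≠b]≡0⇒a≡b (ℕ.m+n≡0⇒m≡0 [ u zero ≠ v zero ] eq)
  dist≡0⇒≗ {suc h} {u} {v} eq (suc i) =
    dist≡0⇒≗ {u = u ∘ suc} {v ∘ suc} (ℕ.m+n≡0⇒n≡0 [ u zero ≠ v zero ] eq) i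

  -- [x ≠ y] = ∑ₐ [x = a][y ≠ a] has rank at most k.
  ≠-term : Fin k → Terms (Fin k)
  ≠-term a = ((λ x → ℤ.1ℤ ℤ.- ℤ.+ [ x ≠ a ]) , (λ y → ℤ.+ [ y ≠ a ])) ∷ []

  ≠-terms : Terms (Fin k)
  ≠-terms = ∑ᵀ ≠-term

  length-≠-terms : length ≠-terms ℕ.≤ k
  length-≠-terms = subst (length ≠-terms ℕ.≤_) (ℕ.*-identityʳ k) (length-∑ᵀ {s = 1} ≠-term λ _ → s≤s z≤n)

  eval-≠-terms : ∀ x y → eval ≠-terms x y ≡ ℤ.+ [ y ≠ x ]
  eval-≠-terms x y =
    trans (eval-∑ᵀ ≠-term x y) (trans (sum-single (λ a → eval (≠-term a) x y) x off) (on x y))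
    where
    on : ∀ x y → (ℤ.1ℤ ℤ.- ℤ.+ [ x ≠ x ]) ℤ.* ℤ.+ [ y ≠ x ] ℤ.+ ℤ.0ℤ ≡ ℤ.+ [ y ≠ x ]
    on x y rewrite [a≠a]≡0 x = trans (ℤ.+-identityʳ (ℤ.1ℤ ℤ.* ℤ.+ [ y ≠ x ])) (ℤ.*-identityˡ (ℤ.+ [ y ≠ x ]))
    off : ∀ a → a ≢ x → (ℤ.1ℤ ℤ.- ℤ.+ [ x ≠ a ]) ℤ.* ℤ.+ [ y ≠ a ] ℤ.+ ℤ.0ℤ ≡ ℤ.0ℤ
    off a a≢x with x Fin.≟ a
    ... | yes x≡a = contradiction (sym x≡a) a≢x
    ... | no  _   = refl

  -- For b = 0 or 1, Pascal's rule reads g (d + 1) (b + w) = g (d + 1) w + b · g d w. Here w is the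
  -- distance of the tails and b, the indicator that the first letters differ, is the matrix
  -- `≠-terms`.
  g-terms : ∀ h → ℕ → Terms (Word h)
  g-terms h       zero    = ((λ _ → ℤ.1ℤ) , (λ _ → ℤ.1ℤ)) ∷ []
  g-terms zero    (suc d) = ((λ _ → g (suc d) 0) , (λ _ → ℤ.1ℤ)) ∷ []
  g-terms (suc h) (suc d) =
    pull (_∘ suc) (g-terms h (suc d)) ++ pull (λ u → u zero) ≠-terms ⊙ pull (_∘ suc) (g-terms h d)

  eval-g-terms : ∀ h d u v → eval (g-terms h d) u v ≡ g d (dist v u)
  eval-g-terms h       zero    u v = refl
  eval-g-terms zero    (suc d) u v =
    trans (ℤ.+-identityʳ (g (suc d) 0 ℤ.* ℤ.1ℤ)) (ℤ.*-identityʳ (g (suc d) 0))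
  eval-g-terms (suc h) (suc d) u v = begin
    eval (g-terms (suc h) (suc d)) u v
      ≡⟨ eval-++ (pull (_∘ suc) (g-terms h (suc d))) _ u v ⟩
    eval (pull (_∘ suc) (g-terms h (suc d))) u v ℤ.+ eval (pull (λ u → u zero) ≠-terms ⊙ pull (_∘ suc) (g-terms h d)) u v
      ≡⟨ cong₂ ℤ._+_ (trans (eval-pull (_∘ suc) (g-terms h (suc d)) u v) (eval-g-terms h (suc d) (u ∘ suc) (v ∘ suc)))
           (trans (eval-⊙ (pull (λ u → u zero) ≠-terms) _ u v)
             (cong₂ ℤ._*_ (trans (eval-pull (λ u → u zero) ≠-terms u v) (eval-≠-terms (u zero) (v zero)))
               (trans (eval-pull (_∘ suc) (g-terms h d) u v) (eval-g-terms h d (u ∘ suc) (v ∘ suc))))) ⟩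
    g (suc d) w ℤ.+ ℤ.+ [ v zero ≠ u zero ] ℤ.* g d w
      ≡⟨ step ⟩
    g (suc d) (dist v u) ∎
    where
    open ≡-Reasoning
    w = dist (v ∘ suc) (u ∘ suc)
    step : g (suc d) w ℤ.+ ℤ.+ [ v zero ≠ u zero ] ℤ.* g d w ≡ g (suc d) ([ v zero ≠ u zero ] ℕ.+ w)
    step with v zero Fin.≟ u zero
    ... | yes _ = trans (cong (λ x → g (suc d) w ℤ.+ x) (ℤ.*-zeroˡ (g d w))) (ℤ.+-identityʳ (g (suc d) w))
    ... | no  _ = cong (λ x → g (suc d) w ℤ.+ x) (ℤ.*-identityˡ (g d w))

  -- One more letter replaces N = 1 + hk by N + k, and N^(d+1) + k N^d = (N + k) N^d ≤ (N +
  -- k)^(d+1).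
  length-g-terms : ∀ h d → length (g-terms h d) ℕ.≤ suc (h ℕ.* k) ℕ.^ d
  length-g-terms h       zero    = s≤s z≤n
  length-g-terms zero    (suc d) = ℕ.≤-reflexive (sym (ℕ.^-zeroˡ (suc d)))
  length-g-terms (suc h) (suc d) = begin
    length (g-terms (suc h) (suc d))
      ≡⟨ List.length-++ (pull (_∘ suc) (g-terms h (suc d))) ⟩
    length (pull (_∘ suc) (g-terms h (suc d))) ℕ.+ length (pull (λ u → u zero) ≠-terms ⊙ pull (_∘ suc) (g-terms h d))
      ≡⟨ cong₂ ℕ._+_ (List.length-map _ (g-terms h (suc d)))
           (trans (length-⊙ (pull (λ u → u zero) ≠-terms) _) (cong₂ ℕ._*_ (List.length-map _ ≠-terms) (List.length-map _ (g-terms h d)))) ⟩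
    length (g-terms h (suc d)) ℕ.+ length ≠-terms ℕ.* length (g-terms h d)
      ≤⟨ ℕ.+-mono-≤ (length-g-terms h (suc d)) (ℕ.*-mono-≤ length-≠-terms (length-g-terms h d)) ⟩
    N ℕ.^ suc d ℕ.+ k ℕ.* N ℕ.^ d  ≡⟨ ℕ.*-distribʳ-+ (N ℕ.^ d) N k ⟨
    (N ℕ.+ k) ℕ.* N ℕ.^ d          ≤⟨ ℕ.*-monoʳ-≤ (N ℕ.+ k) (ℕ.^-monoˡ-≤ d (ℕ.m≤m+n N k)) ⟩
    (N ℕ.+ k) ℕ.^ suc d            ≡⟨ cong (λ x → suc x ℕ.^ suc d) (ℕ.+-comm (h ℕ.* k) k) ⟩
    suc (suc h ℕ.* k) ℕ.^ suc d    ∎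
    where
    open ℕ.≤-Reasoning
    N = suc (h ℕ.* k)

  word : ∀ {n} h → n ℕ.≤ k ℕ.^ h → Fin n → Word h
  word h n≤k^h i = finToFun (inject≤ i n≤k^h)

  funToFin-cong : ∀ {h} {u v : Word h} → u ≗ v → funToFin u ≡ funToFin v
  funToFin-cong {zero}  u≗v = refl
  funToFin-cong {suc h} u≗v = cong₂ combine (u≗v zero) (funToFin-cong (u≗v ∘ suc))

  word-injective : ∀ {n} h (n≤k^h : n ℕ.≤ k ℕ.^ h) {i j} → word h n≤k^h i ≗ word h n≤k^h j → i ≡ j
  word-injective h n≤k^h {i} {j} eq = Fin.inject≤-injective n≤k^h n≤k^h i j (begin
    inject≤ i n≤k^h                       ≡⟨ Fin.funToFin-finToFin {h} (inject≤ i n≤k^h) ⟨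
    funToFin (word h n≤k^h i)               ≡⟨ funToFin-cong {h} eq ⟩
    funToFin (word h n≤k^h j)               ≡⟨ Fin.funToFin-finToFin {h} (inject≤ j n≤k^h) ⟩
    inject≤ j n≤k^h                       ∎)
    where open ≡-Reasoning

-- Coefficients of X B Cᵀ

module _ (m : ℕ) where
  open Polynomials (ℤ/ m)
  private module P {v} = RawSemiringDefs (polynomials v)

  coeff-++ : ∀ {v} (f g : Polynomial v) I → coeff (f ++ g) I ≡ coeff f I ℤ.+ coeff g I
  coeff-++ []            g I = sym (ℤ.+-identityˡ (coeff g I))
  coeff-++ ((a , J) ∷ f) g I with ⌊ Vec.≡-dec ℕ._≟_ J I ⌋
  ... | true  = trans (cong (λ x → a ℤ.+ x) (coeff-++ f g I)) (sym (ℤ.+-assoc a (coeff f I) (coeff g I)))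
  ... | false = coeff-++ f g I

  coeff-sum : ∀ {v n} (F : Fin n → Polynomial v) I → coeff (P.sum F) I ≡ sum λ k → coeff (F k) I
  coeff-sum {n = zero}  F I = refl
  coeff-sum {n = suc n} F I =
    trans (coeff-++ (F zero) _ I) (cong (λ x → coeff (F zero) I ℤ.+ x) (coeff-sum (F ∘ suc) I))

  monomial-*1 : ∀ {v} (J : Monomial v) → Vec.zipWith ℕ._+_ J (replicate v 0) ≡ J
  monomial-*1 = Vec.zipWith-identityʳ ℕ.+-identityʳ

  monomial-1* : ∀ {v} (J : Monomial v) → Vec.zipWith ℕ._+_ (replicate v 0) J ≡ J
  monomial-1* = Vec.zipWith-identityˡ ℕ.+-identityˡ

  coeff-*const : ∀ {v} (f : Polynomial v) b I → coeff (f *ᵖ const b) I ≡ coeff f I ℤ.* b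
  coeff-*const []            b I = sym (ℤ.*-zeroˡ b)
  coeff-*const ((a , J) ∷ f) b I
    rewrite monomial-*1 J
    with ⌊ Vec.≡-dec ℕ._≟_ J I ⌋
  ... | true  = trans (cong (λ x → a ℤ.* b ℤ.+ x) (coeff-*const f b I)) (sym (ℤ.*-distribʳ-+ b a (coeff f I)))
  ... | false = coeff-*const f b I

  coeff-const* : ∀ {v} a (f : Polynomial v) I → coeff (const a *ᵖ f) I ≡ a ℤ.* coeff f I
  coeff-const* a []            I = sym (ℤ.*-zeroʳ a)
  coeff-const* a ((b , J) ∷ f) I
    rewrite monomial-1* J
    with ⌊ Vec.≡-dec ℕ._≟_ J I ⌋
  ... | true  = trans (cong (λ x → a ℤ.* b ℤ.+ x) (coeff-const* a f I)) (sym (ℤ.*-distribˡ-+ a b (coeff f I)))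
  ... | false = coeff-const* a f I

  coeff-var-≡ : ∀ {v} (i : Fin v) → coeff (var i) (replicate v 0 [ i ]≔ 1) ≡ ℤ.1ℤ
  coeff-var-≡ {v} i with Vec.≡-dec ℕ._≟_ (replicate v 0 [ i ]≔ 1) (replicate v 0 [ i ]≔ 1)
  ... | yes _  = refl
  ... | no I≢I = contradiction refl I≢I

  coeff-var-≢ : ∀ {v} (i : Fin v) {I} → replicate v 0 [ i ]≔ 1 ≢ I → coeff (var i) I ≡ ℤ.0ℤ
  coeff-var-≢ {v} i {I} J≢I with Vec.≡-dec ℕ._≟_ (replicate v 0 [ i ]≔ 1) I
  ... | yes J≡I = contradiction J≡I J≢I
  ... | no _    = refl

  var-injective : ∀ {v} {i j : Fin v} → replicate v 0 [ i ]≔ 1 ≡ replicate v 0 [ j ]≔ 1 → i ≡ j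
  var-injective {v} {i} {j} eq with i Fin.≟ j
  ... | yes i≡j = i≡j
  ... | no  i≢j = contradiction (begin
    1                                   ≡⟨ Vec.lookup∘updateAt i (replicate v 0) ⟨
    lookup (replicate v 0 [ i ]≔ 1) i   ≡⟨ cong (λ J → lookup J i) eq ⟩
    lookup (replicate v 0 [ j ]≔ 1) i   ≡⟨ Vec.lookup∘updateAt′ i j i≢j (replicate v 0) ⟩
    lookup (replicate v 0) i            ≡⟨ Vec.lookup-replicate i 0 ⟩
    0                                   ∎) λ ()
    where open ≡-Reasoning

  -- Passing from (X B) Cᵀ to X (B Cᵀ) is done on coefficients, where it is an exchange of two
  -- finite sums of integers.
  coeff-XBCᵀ : ∀ {v n t} (X : Matrix (Polynomial v) n n) (B C : Matrix ℤ n t) i j I →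
    let _·_ = matMul (polynomials v) in
    coeff (((X · constᴹ B) · (constᴹ C ᵀ)) i j) I ≡ sum λ l → coeff (X i l) I ℤ.* sum λ k → B l k ℤ.* C j k
  coeff-XBCᵀ {v} X B C i j I = begin
    coeff (((X · constᴹ B) · (constᴹ C ᵀ)) i j) I
      ≡⟨ coeff-sum (λ k → (X · constᴹ B) i k *ᵖ const (C j k)) I ⟩
    (sum λ k → coeff ((X · constᴹ B) i k *ᵖ const (C j k)) I)
      ≡⟨ sum-cong-≗ (λ k → trans (coeff-*const ((X · constᴹ B) i k) (C j k) I)
           (cong (ℤ._* C j k) (trans (coeff-sum (λ l → X i l *ᵖ const (B l k)) I) (sum-cong-≗ λ l → coeff-*const (X i l) (B l k) I)))) ⟩
    (sum λ k → (sum λ l → coeff (X i l) I ℤ.* B l k) ℤ.* C j k)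
      ≡⟨ sum-cong-≗ (λ k → trans (*-distribʳ-sum (C j k) (λ l → coeff (X i l) I ℤ.* B l k)) (sum-cong-≗ λ l → ℤ.*-assoc (coeff (X i l) I) (B l k) (C j k))) ⟩
    (sum λ k → sum λ l → coeff (X i l) I ℤ.* (B l k ℤ.* C j k))
      ≡⟨ ∑-comm (λ k l → coeff (X i l) I ℤ.* (B l k ℤ.* C j k)) ⟩
    (sum λ l → sum λ k → coeff (X i l) I ℤ.* (B l k ℤ.* C j k))
      ≡⟨ sum-cong-≗ (λ l → *-distribˡ-sum (coeff (X i l) I) (λ k → B l k ℤ.* C j k)) ⟨
    (sum λ l → coeff (X i l) I ℤ.* sum λ k → B l k ℤ.* C j k) ∎
    where
    open ≡-Reasoning
    _·_ = matMul (polynomials v)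

  columns-combine : ∀ {v n t} (X : Matrix (Polynomial v) n n) (B C : Matrix ℤ n t) →
    let _·_ = matMul (polynomials v) in ColumnsAreCombinationsOf ((X · constᴹ B) · (constᴹ C ᵀ)) X
  columns-combine X B C j = (λ l → sum λ k → B l k ℤ.* C j k) , λ i I → mod-reflexive (begin
    _ ≡⟨ coeff-XBCᵀ X B C i j I ⟩
    (sum λ l → coeff (X i l) I ℤ.* a l)              ≡⟨ sum-cong-≗ (λ l → trans (ℤ.*-comm (coeff (X i l) I) (a l)) (sym (coeff-const* (a l) (X i l) I))) ⟩
    (sum λ l → coeff (const (a l) *ᵖ X i l) I)       ≡⟨ coeff-sum (λ l → const (a l) *ᵖ X i l) I ⟨
    coeff (P.sum λ l → const (a l) *ᵖ X i l) I       ∎)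
    where
    open ≡-Reasoning
    a = λ l → sum λ k → B l k ℤ.* C j k

-- Strong representations from constant matrices

module _ {m} (F : PrimePowerFactorisation m) where
  open PrimePowerFactorisation F
  open Polynomials (ℤ/ m)
  open Representations F

  -- Column j of B Cᵀ lists the coefficients of entry (i, j) at the indeterminates of row i, and no
  -- other monomial occurs there. The diagonal entry belongs to xᵢⱼ itself, the others to
  -- indeterminates that are absent from xᵢⱼ.
  strong-representation : ∀ {n t} (B C : Matrix ℤ n t) → Fin r →
    (∀ j k → ℤ.1ℤ ≅ (sum λ q → B j q ℤ.* C j q) mod component k) →
    (∀ l j → l ≢ j → ∃[ k ] ℤ.0ℤ ≅ (sum λ q → B l q ℤ.* C j q) mod component k) →
    let X = indeterminates n
        _·_ = matMul (polynomials _)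
    in Is1-a-StrongMatrixRep ((X · constᴹ B) · (constᴹ C ᵀ)) X
  strong-representation {n} B C k₀ diagonal off-diagonal i j = alternative , strong
    where
    _·_ = matMul (polynomials _)
    X = indeterminates n
    D = (X · constᴹ B) · (constᴹ C ᵀ)
    A = λ l → sum λ q → B l q ℤ.* C j q
    monomial : Fin n → Monomial (n ℕ.* n)
    monomial l = replicate _ 0 [ combine i l ]≔ 1
    monomial-injective : ∀ {l l′} → monomial l ≡ monomial l′ → l ≡ l′
    monomial-injective {l} {l′} eq = Fin.combine-injectiveʳ i l i l′ (var-injective m eq)
    coeff-D-monomial : ∀ l → coeff (D i j) (monomial l) ≡ A l
    coeff-D-monomial l = begin
      coeff (D i j) I                                    ≡⟨ coeff-XBCᵀ m X B C i j I ⟩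
      (sum λ l′ → coeff (X i l′) I ℤ.* A l′)             ≡⟨ sum-single (λ l′ → coeff (X i l′) I ℤ.* A l′) l (λ l′ l′≢l →
        cong (ℤ._* A l′) (coeff-var-≢ m (combine i l′) (λ eq → l′≢l (monomial-injective eq)))) ⟩
      coeff (X i l) I ℤ.* A l                            ≡⟨ cong (ℤ._* A l) (coeff-var-≡ m (combine i l)) ⟩
      ℤ.1ℤ ℤ.* A l                                       ≡⟨ ℤ.*-identityˡ (A l) ⟩
      A l                                                ∎
      where
      open ≡-Reasoning
      I = monomial l
    coeff-D-other : ∀ {I} → (∀ l → monomial l ≢ I) → coeff (D i j) I ≡ ℤ.0ℤ
    coeff-D-other {I} ≢I = trans (coeff-XBCᵀ m X B C i j I)
      (sum-0 _ λ l → cong (ℤ._* A l) (coeff-var-≢ m (combine i l) (≢I l)))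
    -- Both clauses of the definition follow from one case distinction: agreement modulo every
    -- component, or a coefficient 0 of xᵢⱼ together with agreement modulo one component.
    data Comparison (I : Monomial (n ℕ.* n)) : Set where
      same   : (∀ k → coeff (X i j) I ≅ coeff (D i j) I mod component k) → Comparison I
      differ : coeff (X i j) I ≡ ℤ.0ℤ → ∃[ k ] coeff (X i j) I ≅ coeff (D i j) I mod component k → Comparison I
    compare : ∀ I → Comparison I
    compare I with Fin.any? (λ l → Vec.≡-dec ℕ._≟_ (monomial l) I)
    ... | no ∄l = same λ k → mod-reflexive (trans (coeff-var-≢ m (combine i j) (λ eq → ∄l (j , eq)))
      (sym (coeff-D-other λ l eq → ∄l (l , eq))))
    ... | yes (l , refl) with l Fin.≟ j
    ...   | yes refl = same λ k → subst₂ (_≅_mod component k)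
      (sym (coeff-var-≡ m (combine i j))) (sym (coeff-D-monomial j)) (diagonal j k)
    ...   | no l≢j = differ X≡0 (let (k , A≅0) = off-diagonal l j l≢j in
      k , subst₂ (_≅_mod component k) (sym X≡0) (sym (coeff-D-monomial l)) A≅0)
      where
      X≡0 : coeff (X i j) (monomial l) ≡ ℤ.0ℤ
      X≡0 = coeff-var-≢ m (combine i j) (λ eq → l≢j (sym (monomial-injective eq)))
    alternative : IsAlternativeRep (D i j) (X i j)
    alternative I with compare I
    -- An alternative representation must name a component even where all of them agree; `k₀`
    -- supplies one.
    ... | same eq   = k₀ , eq k₀
    ... | differ _ eq = eq
    strong : ∀ I → (∃[ k ] ¬ (coeff (X i j) I ≅ coeff (D i j) I mod component k)) → coeff (X i j) I ≅ ℤ.0ℤ mod m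
    strong I (k , X≇D) with compare I
    ... | same eq    = contradiction (eq k) X≇D
    ... | differ X≡0 _ = mod-reflexive X≡0

-- Rational arithmetic and lower bounds for reals

^-distribʳ-* : ∀ k a b → (a ℕ.* b) ℕ.^ k ≡ a ℕ.^ k ℕ.* b ℕ.^ k
^-distribʳ-* zero    a b = refl
^-distribʳ-* (suc k) a b =
  trans (cong (a ℕ.* b ℕ.*_) (^-distribʳ-* k a b)) (ℕ.[m*n]*[o*p]≡[m*o]*[n*p] a b (a ℕ.^ k) (b ℕ.^ k))

module _ where
  open import Data.Rational.Base using (_+_; _*_; -_; _-_; _/_)

  frac : ℕ → (d : ℕ) → .{{NonZero d}} → ℚ
  frac a d = ℤ.+ a / d

  fromℚᵘ-* : ∀ p q → fromℚᵘ p * fromℚᵘ q ≡ fromℚᵘ (p ℚᵘ.* q)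
  fromℚᵘ-* p q = ℚ.toℚᵘ-injective (ℚᵘ.≃-trans (ℚ.toℚᵘ-homo-* (fromℚᵘ p) (fromℚᵘ q))
    (ℚᵘ.≃-trans (ℚᵘ.*-cong (ℚ.toℚᵘ-fromℚᵘ p) (ℚ.toℚᵘ-fromℚᵘ q)) (ℚᵘ.≃-sym (ℚ.toℚᵘ-fromℚᵘ (p ℚᵘ.* q)))))

  fromℚᵘ-+ : ∀ p q → fromℚᵘ p + fromℚᵘ q ≡ fromℚᵘ (p ℚᵘ.+ q)
  fromℚᵘ-+ p q = ℚ.toℚᵘ-injective (ℚᵘ.≃-trans (ℚ.toℚᵘ-homo-+ (fromℚᵘ p) (fromℚᵘ q))
    (ℚᵘ.≃-trans (ℚᵘ.+-cong (ℚ.toℚᵘ-fromℚᵘ p) (ℚ.toℚᵘ-fromℚᵘ q)) (ℚᵘ.≃-sym (ℚ.toℚᵘ-fromℚᵘ (p ℚᵘ.+ q)))))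

  fromℚᵘ-mono-≤ : ∀ {p q} → p ℚᵘ.≤ q → fromℚᵘ p ℚ.≤ fromℚᵘ q
  fromℚᵘ-mono-≤ {p} {q} p≤q = ℚ.toℚᵘ-cancel-≤ (ℚᵘ.≤-respʳ-≃ (ℚᵘ.≃-sym (ℚ.toℚᵘ-fromℚᵘ q))
    (ℚᵘ.≤-respˡ-≃ (ℚᵘ.≃-sym (ℚ.toℚᵘ-fromℚᵘ p)) p≤q))

  fromℚᵘ-mono-< : ∀ {p q} → p ℚᵘ.< q → fromℚᵘ p ℚ.< fromℚᵘ q
  fromℚᵘ-mono-< {p} {q} p<q = ℚ.toℚᵘ-cancel-< (ℚᵘ.<-respʳ-≃ (ℚᵘ.≃-sym (ℚ.toℚᵘ-fromℚᵘ q))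
    (ℚᵘ.<-respˡ-≃ (ℚᵘ.≃-sym (ℚ.toℚᵘ-fromℚᵘ p)) p<q))

  frac-≤ : ∀ a b c d .{{_ : NonZero b}} .{{_ : NonZero d}} → a ℕ.* d ℕ.≤ c ℕ.* b → frac a b ℚ.≤ frac c d
  frac-≤ a (suc b) c (suc d) h = fromℚᵘ-mono-≤ {mkℚᵘ (ℤ.+ a) b} {mkℚᵘ (ℤ.+ c) d}
    (ℚᵘ.*≤* (subst₂ ℤ._≤_ (ℤ.pos-* a (suc d)) (ℤ.pos-* c (suc b)) (ℤ.+≤+ h)))

  frac-< : ∀ a b c d .{{_ : NonZero b}} .{{_ : NonZero d}} → a ℕ.* d ℕ.< c ℕ.* b → frac a b ℚ.< frac c d
  frac-< a (suc b) c (suc d) h = fromℚᵘ-mono-< {mkℚᵘ (ℤ.+ a) b} {mkℚᵘ (ℤ.+ c) d}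
    (ℚᵘ.*<* (subst₂ ℤ._<_ (ℤ.pos-* a (suc d)) (ℤ.pos-* c (suc b)) (ℤ.+<+ h)))

  frac-≡ : ∀ a b c d .{{_ : NonZero b}} .{{_ : NonZero d}} → a ℕ.* d ≡ c ℕ.* b → frac a b ≡ frac c d
  frac-≡ a b c d eq =
    ℚ.≤-antisym (frac-≤ a b c d (ℕ.≤-reflexive eq)) (frac-≤ c d a b (ℕ.≤-reflexive (sym eq)))

  frac-* : ∀ a b c d .{{_ : NonZero b}} .{{_ : NonZero d}} .{{_ : NonZero (b ℕ.* d)}} →
    frac a b * frac c d ≡ frac (a ℕ.* c) (b ℕ.* d)
  frac-* a (suc b) c (suc d) = trans (fromℚᵘ-* (mkℚᵘ (ℤ.+ a) b) (mkℚᵘ (ℤ.+ c) d))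
    (cong (λ i → i / suc (d ℕ.+ b ℕ.* suc d)) (sym (ℤ.pos-* a c)))

  ι : ℕ → ℚ
  ι n = frac n 1

  ι-suc : ∀ n → ι (suc n) ≡ 1ℚ + ι n
  ι-suc n = sym (trans (fromℚᵘ-+ (mkℚᵘ (ℤ.+ 1) 0) (mkℚᵘ (ℤ.+ n) 0))
    (cong (λ i → (ℤ.+ 1 ℤ.+ i) / 1) (ℤ.*-identityʳ (ℤ.+ n))))

  ι-inverse : ∀ k → ι (suc k) * (ℤ.1ℤ / suc k) ≡ 1ℚ
  ι-inverse k = trans (frac-* K 1 1 K) (frac-≡ (K ℕ.* 1) (1 ℕ.* K) 1 1
    (trans (ℕ.*-identityʳ (K ℕ.* 1)) (trans (ℕ.*-comm K 1) (sym (ℕ.*-identityˡ (1 ℕ.* K))))))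
    where K = suc k

  ι-mono-< : ∀ {m n} → m ℕ.< n → ι m ℚ.< ι n
  ι-mono-< {m} {n} m<n = frac-< m 1 n 1 (ℕ.*-monoˡ-< 1 m<n)

  0≤frac : ∀ a d .{{_ : NonZero d}} → 0ℚ ℚ.≤ frac a d
  0≤frac a d = frac-≤ 0 1 a d ℕ.z≤n

  0≤1 : 0ℚ ℚ.≤ 1ℚ
  0≤1 = 0≤frac 1 1

  *-mono-≤ : ∀ {a b c d} → 0ℚ ℚ.≤ a → 0ℚ ℚ.≤ c → a ℚ.≤ b → c ℚ.≤ d → a * c ℚ.≤ b * d
  *-mono-≤ {a} {b} {c} {d} 0≤a 0≤c a≤b c≤d = ℚ.≤-trans
    (ℚ.*-monoʳ-≤-nonNeg c {{ℚ.nonNegative 0≤c}} a≤b)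
    (ℚ.*-monoˡ-≤-nonNeg b {{ℚ.nonNegative (ℚ.≤-trans 0≤a a≤b)}} c≤d)

  *-mono-< : ∀ {a b c d} → 0ℚ ℚ.≤ a → 0ℚ ℚ.≤ c → a ℚ.< b → c ℚ.< d → a * c ℚ.< b * d
  *-mono-< {a} {b} {c} {d} 0≤a 0≤c a<b c<d = ℚ.≤-<-trans
    (ℚ.*-monoʳ-≤-nonNeg c {{ℚ.nonNegative 0≤c}} (ℚ.<⇒≤ a<b))
    (ℚ.*-monoʳ-<-pos b {{ℚ.positive (ℚ.≤-<-trans 0≤a a<b)}} c<d)

  0≤* : ∀ {a b} → 0ℚ ℚ.≤ a → 0ℚ ℚ.≤ b → 0ℚ ℚ.≤ a * b
  0≤* 0≤a 0≤b = *-mono-≤ ℚ.≤-refl ℚ.≤-refl 0≤a 0≤b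

  0≤^ : ∀ {a} n → 0ℚ ℚ.≤ a → 0ℚ ℚ.≤ a ^ℚ n
  0≤^ zero    0≤a = 0≤1
  0≤^ (suc n) 0≤a = 0≤* 0≤a (0≤^ n 0≤a)

  ^-monoˡ-≤ : ∀ {a b} n → 0ℚ ℚ.≤ a → a ℚ.≤ b → a ^ℚ n ℚ.≤ b ^ℚ n
  ^-monoˡ-≤ zero    0≤a a≤b = ℚ.≤-refl
  ^-monoˡ-≤ (suc n) 0≤a a≤b = *-mono-≤ 0≤a (0≤^ n 0≤a) a≤b (^-monoˡ-≤ n 0≤a a≤b)

  frac-^ : ∀ a b k .{{_ : NonZero b}} .{{_ : NonZero (b ℕ.^ k)}} → frac a b ^ℚ k ≡ frac (a ℕ.^ k) (b ℕ.^ k)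
  frac-^ a b zero    = refl
  frac-^ a b (suc k) = trans (cong (frac a b *_) (frac-^ a b k)) (frac-* a b (a ℕ.^ k) (b ℕ.^ k))
    where instance _ = ℕ.m^n≢0 b k

  0≤a² : ∀ a → 0ℚ ℚ.≤ a * a
  0≤a² a with ℚ.≤-total 0ℚ a
  ... | inj₁ 0≤a = 0≤* 0≤a 0≤a
  ... | inj₂ a≤0 = subst (0ℚ ℚ.≤_) ([-a][-a]≡aa a) (0≤* 0≤-a 0≤-a)
    where
    0≤-a = ℚ.neg-antimono-≤ a≤0
    [-a][-a]≡aa : ∀ a → - a * - a ≡ a * a
    [-a][-a]≡aa = solve 1 (λ a → (:- a) :* (:- a) := a :* a) refl where open ℚ-Solver

  -- The induction step discards only n z² ≥ 0. Negative z down to -1 are included because the upper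
  -- bound for `exp` applies the inequality with both signs.
  bernoulli : ∀ n z → 0ℚ ℚ.≤ 1ℚ + z → 1ℚ + ι n * z ℚ.≤ (1ℚ + z) ^ℚ n
  bernoulli zero    z 0≤1+z = ℚ.≤-reflexive (trans (cong (1ℚ +_) (ℚ.*-zeroˡ z)) (ℚ.+-identityʳ 1ℚ))
  bernoulli (suc n) z 0≤1+z = begin
    1ℚ + ι (suc n) * z               ≡⟨ cong (λ x → 1ℚ + x * z) (ι-suc n) ⟩
    1ℚ + (1ℚ + ι n) * z              ≡⟨ ℚ.+-identityʳ _ ⟨
    1ℚ + (1ℚ + ι n) * z + 0ℚ         ≤⟨ ℚ.+-monoʳ-≤ (1ℚ + (1ℚ + ι n) * z) (0≤* (0≤frac n 1) (0≤a² z)) ⟩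
    1ℚ + (1ℚ + ι n) * z + ι n * (z * z) ≡⟨ expand (ι n) z ⟩
    (1ℚ + z) * (1ℚ + ι n * z)        ≤⟨ ℚ.*-monoˡ-≤-nonNeg (1ℚ + z) {{ℚ.nonNegative 0≤1+z}} (bernoulli n z 0≤1+z) ⟩
    (1ℚ + z) ^ℚ suc n                ∎
    where
    open ℚ.≤-Reasoning
    expand : ∀ x z → 1ℚ + (1ℚ + x) * z + x * (z * z) ≡ (1ℚ + z) * (1ℚ + x * z)
    expand =
      solve 2 (λ x z → con 1ℚ :+ (con 1ℚ :+ x) :* z :+ x :* (z :* z) := (con 1ℚ :+ z) :* (con 1ℚ :+ x :* z)) refl
      where open ℚ-Solver

  -- With z = y / K, Bernoulli gives 1 + M y / K ≤ (1 + z)^M and 1 − y ≤ (1 − z)^K,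
  -- hence (1 + M y / K)^K (1 − y)^M ≤ (1 − z²)^(M K) ≤ 1.
  exp-upper : ∀ M y q → 0ℚ ℚ.≤ y → y ℚ.≤ 1ℚ → 0ℚ ℚ.≤ q → 1ℚ ℚ.≤ q * (1ℚ - y) ^ℚ M → exp (fromℚ (ι M * y)) ≤ᴿ fromℚ q
  exp-upper M y q 0≤y y≤1 0≤q 1≤q[1-y]^M u (_ , (q′ , (_ , refl , q′<My) , k , 0≤b , refl) , u<b^K) =
    q , refl , ℚ.<-≤-trans u<b^K (begin
      b ^ℚ K                                   ≡⟨ ℚ.*-identityʳ _ ⟨
      b ^ℚ K * 1ℚ
        ≤⟨ *-mono-≤ (0≤^ K 0≤b) 0≤1 b^K≤ (ℚ.≤-trans 1≤q[1-y]^M (ℚ.*-monoˡ-≤-nonNeg q {{ℚ.nonNegative 0≤q}} 1-y≤)) ⟩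
      (1ℚ + z) ^ℚ (M ℕ.* K) * (q * (1ℚ - z) ^ℚ (M ℕ.* K))  ≡⟨ swap ((1ℚ + z) ^ℚ (M ℕ.* K)) q ((1ℚ - z) ^ℚ (M ℕ.* K)) ⟩
      q * ((1ℚ + z) ^ℚ (M ℕ.* K) * (1ℚ - z) ^ℚ (M ℕ.* K))
        ≡⟨ cong (q *_) (^-distrib-* (1ℚ + z) (1ℚ - z) (M ℕ.* K)) ⟨
      q * ((1ℚ + z) * (1ℚ - z)) ^ℚ (M ℕ.* K)
        ≤⟨ ℚ.*-monoˡ-≤-nonNeg q {{ℚ.nonNegative 0≤q}} (^-monoˡ-≤ (M ℕ.* K) (0≤* 0≤1+z 0≤1-z) 1-z²≤1) ⟩
      q * 1ℚ ^ℚ (M ℕ.* K)                      ≡⟨ cong (q *_) (1^ (M ℕ.* K)) ⟩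
      q * 1ℚ                                   ≡⟨ ℚ.*-identityʳ q ⟩
      q                                        ∎)
    where
    open ℚ.≤-Reasoning
    K = suc k
    κ = ℤ.1ℤ / suc k
    b = 1ℚ + q′ * κ
    z = y * κ
    0≤κ : 0ℚ ℚ.≤ κ
    0≤κ = 0≤frac 1 K
    κ≤1 : κ ℚ.≤ 1ℚ
    κ≤1 = frac-≤ 1 K 1 1 (ℕ.*-monoʳ-≤ 1 (ℕ.s≤s ℕ.z≤n))
    0≤z : 0ℚ ℚ.≤ z
    0≤z = 0≤* 0≤y 0≤κ
    z≤1 : z ℚ.≤ 1ℚ
    z≤1 = *-mono-≤ 0≤y 0≤κ y≤1 κ≤1
    0≤1+z : 0ℚ ℚ.≤ 1ℚ + z
    0≤1+z = ℚ.+-mono-≤ 0≤1 0≤z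
    0≤1-z : 0ℚ ℚ.≤ 1ℚ - z
    0≤1-z = ℚ.+-monoʳ-≤ 1ℚ (ℚ.neg-antimono-≤ z≤1)
    0≤1-y : 0ℚ ℚ.≤ 1ℚ - y
    0≤1-y = ℚ.+-monoʳ-≤ 1ℚ (ℚ.neg-antimono-≤ y≤1)
    1^ : ∀ n → 1ℚ ^ℚ n ≡ 1ℚ
    1^ zero = refl
    1^ (suc n) = trans (ℚ.*-identityˡ _) (1^ n)
    swap : ∀ x q w → x * (q * w) ≡ q * (x * w)
    swap = solve 3 (λ x q w → x :* (q :* w) := q :* (x :* w)) refl where open ℚ-Solver
    1-z²≤1 : (1ℚ + z) * (1ℚ - z) ℚ.≤ 1ℚ
    1-z²≤1 = begin
      (1ℚ + z) * (1ℚ - z) ≡⟨ solve 1 (λ z → (con 1ℚ :+ z) :* (con 1ℚ :- z) := con 1ℚ :+ (:- (z :* z))) refl z ⟩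
      1ℚ + - (z * z)      ≤⟨ ℚ.+-monoʳ-≤ 1ℚ (ℚ.neg-antimono-≤ (0≤a² z)) ⟩
      1ℚ + - 0ℚ           ≡⟨⟩
      1ℚ ∎
      where open ℚ-Solver
    b^K≤ : b ^ℚ K ℚ.≤ (1ℚ + z) ^ℚ (M ℕ.* K)
    b^K≤ = begin
      b ^ℚ K ≤⟨ ^-monoˡ-≤ K 0≤b (begin
        1ℚ + q′ * κ   ≤⟨ ℚ.+-monoʳ-≤ 1ℚ (ℚ.*-monoʳ-≤-nonNeg κ {{ℚ.nonNegative 0≤κ}} (ℚ.<⇒≤ q′<My)) ⟩
        1ℚ + ι M * y * κ ≡⟨ cong (1ℚ +_) (ℚ.*-assoc (ι M) y κ) ⟩
        1ℚ + ι M * z     ≤⟨ bernoulli M z 0≤1+z ⟩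
        (1ℚ + z) ^ℚ M ∎) ⟩
      ((1ℚ + z) ^ℚ M) ^ℚ K ≡⟨ ^-assocʳ (1ℚ + z) M K ⟩
      (1ℚ + z) ^ℚ (M ℕ.* K) ∎
    1-y≤ : (1ℚ - y) ^ℚ M ℚ.≤ (1ℚ - z) ^ℚ (M ℕ.* K)
    1-y≤ = begin
      (1ℚ - y) ^ℚ M ≤⟨ ^-monoˡ-≤ M 0≤1-y (begin
        1ℚ - y
          ≡⟨ cong (λ x → 1ℚ + - x) (trans (sym (ℚ.*-identityʳ y)) (trans (cong (y *_) (sym (ι-inverse k))) (swap y (ι K) κ))) ⟩
        1ℚ + - (ι K * z) ≡⟨ cong (1ℚ +_) (ℚ.neg-distribʳ-* (ι K) z) ⟩
        1ℚ + ι K * - z  ≤⟨ bernoulli K (- z) 0≤1-z ⟩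
        (1ℚ - z) ^ℚ K ∎) ⟩
      ((1ℚ - z) ^ℚ K) ^ℚ M  ≡⟨ ^-assocʳ (1ℚ - z) K M ⟩
      (1ℚ - z) ^ℚ (K ℕ.* M)  ≡⟨ cong ((1ℚ - z) ^ℚ_) (ℕ.*-comm K M) ⟩
      (1ℚ - z) ^ℚ (M ℕ.* K) ∎

  -- The cut of `log` is described through upper bounds for `exp`, so every lower bound for a
  -- logarithm starts from an instance of `exp-upper`.
  log-∈ : ∀ {x s s′ q} → exp (fromℚ s) ≤ᴿ fromℚ q → q ∈ x → s′ ℚ.< s → s′ ∈ log x
  log-∈ {s = s} {q = q} eˢ≤q q<x s′<s = s , (q , q<x , eˢ≤q) , s′<s

  -- A supremum contains only rationals strictly below its generators, so both factors are first
  -- enlarged by roundedness.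
  *ᴿ-∈ : ∀ {x y a b} → 0ℚ ℚ.≤ a → 0ℚ ℚ.≤ b → a ∈ x → b ∈ y → a * b ∈ x *ᴿ y
  *ᴿ-∈ {x} {y} 0≤a 0≤b a∈x b∈y with Real.rounded x a∈x | Real.rounded y b∈y
  ... | a′ , a<a′ , a′∈x | b′ , b<b′ , b′∈y =
    a′ * b′ , (a′ , b′ , a′∈x , b′∈y , ℚ.≤-trans 0≤a (ℚ.<⇒≤ a<a′) , ℚ.≤-trans 0≤b (ℚ.<⇒≤ b<b′) , refl) ,
    *-mono-< 0≤a 0≤b a<a′ b<b′

  -- The factor ½ lies in the cut of x ^ᴿ 0, which does not contain 1.
  ^ᴿ-∈ : ∀ {y b} j → 0ℚ ℚ.≤ b → b ∈ y → b * ½ ∈ y → (b * ½) ^ℚ suc j ∈ y ^ᴿ suc j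
  ^ᴿ-∈ {y} {b} zero    0≤b b∈y b/2∈y = subst (_∈ y ^ᴿ 1) (sym (ℚ.*-identityʳ (b * ½)))
    (*ᴿ-∈ {y} {fromℚ 1ℚ} 0≤b (0≤frac 1 2) b∈y (1ℚ , refl , from-yes (½ ℚ.<? 1ℚ)))
  ^ᴿ-∈ {y} (suc j) 0≤b b∈y b/2∈y =
    *ᴿ-∈ {y} {y ^ᴿ suc j} 0≤b/2 (0≤^ (suc j) 0≤b/2) b/2∈y (^ᴿ-∈ {y} j 0≤b b∈y b/2∈y)
    where 0≤b/2 = 0≤* 0≤b (0≤frac 1 2)

  root-∈ : ∀ {x a b} k → 0ℚ ℚ.≤ a → a ℚ.< b → b ^ℚ k ∈ x → a ∈ root k x
  root-∈ {b = b} k 0≤a a<b b^k∈x = b , (ℚ.≤-trans 0≤a (ℚ.<⇒≤ a<b) , b^k∈x) , a<b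

  -- Among the approximations (1 + q/N)^N the choice q = N = `suc k` has base exactly 2.
  2^≤exp : ∀ {x} k → ι (suc k) ∈ x → fromℕ (2 ℕ.^ suc k) ≤ᴿ exp x
  2^≤exp {x} k k∈x q (_ , refl , q<2^k) = b ^ℚ K , (ι K , k∈x , k , 0≤b , refl) ,
    subst (q ℚ.<_) (sym b^K≡) q<2^k
    where
    K = suc k
    b = 1ℚ + ι K * (ℤ.1ℤ / K)
    b≡2 : b ≡ ι 2
    b≡2 = cong (1ℚ +_) (ι-inverse k)
    0≤b : 0ℚ ℚ.≤ b
    0≤b = subst (0ℚ ℚ.≤_) (sym b≡2) (0≤frac 2 1)
    instance
      1^K≢0 : NonZero (1 ℕ.^ K)
      1^K≢0 = ℕ.m^n≢0 1 K
    b^K≡ : b ^ℚ K ≡ ι (2 ℕ.^ K)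
    b^K≡ = trans (cong (_^ℚ K) b≡2) (trans (frac-^ 2 1 K)
      (frac-≡ (2 ℕ.^ K) (1 ℕ.^ K) (2 ℕ.^ K) 1 (cong (2 ℕ.^ K ℕ.*_) (sym (ℕ.^-zeroˡ K)))))

  -- This is `exp-upper` at y = ½, where 2^n (1 - ½)^n = 1. The loss against log 2 is only a
  -- constant factor.
  exp[n/2]≤2^n : ∀ n → exp (fromℚ (frac n 2)) ≤ᴿ fromℚ (ι (2 ℕ.^ n))
  exp[n/2]≤2^n n = subst (λ s → exp (fromℚ s) ≤ᴿ fromℚ (ι (2 ℕ.^ n)))
    (trans (frac-* n 1 1 2) (cong (λ a → frac a 2) (ℕ.*-identityʳ n)))
    (exp-upper n ½ (ι (2 ℕ.^ n)) (0≤frac 1 2) (frac-≤ 1 2 1 1 (ℕ.s≤s ℕ.z≤n)) (0≤frac (2 ℕ.^ n) 1)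
      (ℚ.≤-reflexive (sym 2^n½^n≡1)))
    where
    instance
      2^n≢0 : NonZero (2 ℕ.^ n)
      2^n≢0 = ℕ.m^n≢0 2 n
      1*2^n≢0 : NonZero (1 ℕ.* 2 ℕ.^ n)
      1*2^n≢0 = ℕ.m*n≢0 1 (2 ℕ.^ n)
    2^n½^n≡1 : ι (2 ℕ.^ n) * ½ ^ℚ n ≡ 1ℚ
    2^n½^n≡1 = trans (cong (ι (2 ℕ.^ n) *_) (frac-^ 1 2 n)) (trans (frac-* (2 ℕ.^ n) 1 (1 ℕ.^ n) (2 ℕ.^ n))
      (frac-≡ (2 ℕ.^ n ℕ.* 1 ℕ.^ n) (1 ℕ.* 2 ℕ.^ n) 1 1
        (trans (ℕ.*-identityʳ (2 ℕ.^ n ℕ.* 1 ℕ.^ n)) (trans (cong (2 ℕ.^ n ℕ.*_) (ℕ.^-zeroˡ n)) (trans (ℕ.*-comm (2 ℕ.^ n) 1) (sym (ℕ.*-identityˡ (1 ℕ.* 2 ℕ.^ n))))))))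

  -- log log n > 0 for every n ≥ 3 because log 3 > 21/20 and log (21/20) > 1/24.
  exp[21/20]≤299/100 : exp (fromℚ (frac 21 20)) ≤ᴿ fromℚ (frac 299 100)
  exp[21/20]≤299/100 =
    exp-upper 21 (frac 1 20) (frac 299 100) (0≤frac 1 20) (frac-≤ 1 20 1 1 (ℕ.s≤s ℕ.z≤n)) (0≤frac 299 100)
    (subst (1ℚ ℚ.≤_) (sym (trans (cong (frac 299 100 *_) (frac-^ 19 20 21)) (frac-* 299 100 (19 ℕ.^ 21) (20 ℕ.^ 21))))
      (frac-≤ 1 1 (299 ℕ.* 19 ℕ.^ 21) (100 ℕ.* 20 ℕ.^ 21) (from-yes (1 ℕ.* (100 ℕ.* 20 ℕ.^ 21) ℕ.≤? 299 ℕ.* 19 ℕ.^ 21 ℕ.* 1))))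

  exp[1/24]≤24/23 : exp (fromℚ (frac 1 24)) ≤ᴿ fromℚ (frac 24 23)
  exp[1/24]≤24/23 =
    exp-upper 1 (frac 1 24) (frac 24 23) (0≤frac 1 24) (frac-≤ 1 24 1 1 (ℕ.s≤s ℕ.z≤n)) (0≤frac 24 23)
    (ℚ.≤-reflexive refl)

  log-lower : ∀ {n} l → 1 ℕ.≤ l → 2 ℕ.^ l ℕ.< n → frac l 4 ∈ log (fromℕ n)
  log-lower {n} l 1≤l 2^l<n = log-∈ {fromℕ n} (exp[n/2]≤2^n l) (ι n , refl , ι-mono-< 2^l<n)
    (frac-< l 4 l 2 (ℕ.*-monoʳ-< l {{ℕ.>-nonZero 1≤l}} (ℕ.s≤s (ℕ.s≤s (ℕ.s≤s ℕ.z≤n)))))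

  -- For such a the bound through l is too weak: at n = 3 it gives log n > l/2 = ½, whose logarithm
  -- is negative. Instead n > 299/100 gives log n > 24/23 and log log n above every rational below
  -- 1/24; the denominator 100 ensures 3/100 < 1/24.
  loglog-lower-small : ∀ {n} a → 3 ℕ.≤ n → a ℕ.≤ 3 → frac a 100 ∈ log (log (fromℕ n))
  loglog-lower-small {n} a 3≤n a≤3 = log-∈ {log (fromℕ n)} exp[1/24]≤24/23
    (log-∈ {fromℕ n} exp[21/20]≤299/100
      (ι n , refl , frac-< 299 100 n 1 (ℕ.<-≤-trans (from-yes (299 ℕ.* 1 ℕ.<? 3 ℕ.* 100)) (ℕ.*-monoˡ-≤ 100 3≤n)))
      (frac-< 24 23 21 20 (from-yes (24 ℕ.* 20 ℕ.<? 21 ℕ.* 23))))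
    (frac-< a 100 1 24 (ℕ.≤-<-trans (ℕ.*-monoˡ-≤ 24 a≤3) (from-yes (72 ℕ.<? 100))))

  -- Two logarithms are taken: log n exceeds 2^(1+b), which is below l/2, and the logarithm of
  -- 2^(1+b) is at least (1 + b)/2, far above (4 + b)/100.
  loglog-lower-large : ∀ {n} l b → 2 ℕ.^ l ℕ.< n → 2 ℕ.^ (3 ℕ.+ b) ℕ.≤ l → frac (4 ℕ.+ b) 100 ∈ log (log (fromℕ n))
  loglog-lower-large {n} l b 2^l<n 2^[3+b]≤l = log-∈ {log (fromℕ n)} (exp[n/2]≤2^n (1 ℕ.+ b))
    (log-∈ {fromℕ n} (exp[n/2]≤2^n l) (ι n , refl , ι-mono-< 2^l<n)
      (frac-< (2 ℕ.^ (1 ℕ.+ b)) 1 l 2 (subst (2 ℕ.^ (1 ℕ.+ b) ℕ.* 2 ℕ.<_) (sym (ℕ.*-identityʳ l))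
        (ℕ.<-≤-trans (subst (ℕ._< 2 ℕ.^ (3 ℕ.+ b)) (ℕ.*-comm 2 (2 ℕ.^ (1 ℕ.+ b)))
          (ℕ.^-monoʳ-< 2 (ℕ.s≤s (ℕ.s≤s ℕ.z≤n)) (ℕ.n<1+n (2 ℕ.+ b)))) 2^[3+b]≤l))))
    (frac-< (4 ℕ.+ b) 100 (1 ℕ.+ b) 2 (subst ((4 ℕ.+ b) ℕ.* 2 ℕ.<_) (split b) (ℕ.m<m+n ((4 ℕ.+ b) ℕ.* 2) (ℕ.s≤s ℕ.z≤n))))
    where
    split : ∀ b → (4 ℕ.+ b) ℕ.* 2 ℕ.+ (92 ℕ.+ 98 ℕ.* b) ≡ (1 ℕ.+ b) ℕ.* 100
    split =
      solve 1 (λ b → (con 4 :+ b) :* con 2 :+ (con 92 :+ con 98 :* b) := (con 1 :+ b) :* con 100) refl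
      where open ℕ-Solver

  loglog-lower : ∀ {n} l a → 3 ℕ.≤ n → 2 ℕ.^ l ℕ.< n → 2 ℕ.^ (a ∸ 1) ℕ.≤ l → frac a 100 ∈ log (log (fromℕ n))
  loglog-lower l a 3≤n 2^l<n 2^[a-1]≤l with a ℕ.≤? 3
  ... | yes a≤3 = loglog-lower-small a 3≤n a≤3
  ... | no  a≰3 with ℕ.≰⇒> a≰3
  ... | ℕ.s≤s (ℕ.s≤s (ℕ.s≤s (ℕ.s≤s {n = b} _))) = loglog-lower-large l b 2^l<n 2^[a-1]≤l

  -- With r = 1 + j, (a s)^r = a s^r · a^(r-1). As l and a stand for log n and log log n, this is
  -- the origin of log n (log log n)^(r-1) under the root.
  [as]^[1+j]≤ : ∀ {l} a s j → a ℕ.* s ℕ.^ suc j ℕ.≤ l → (a ℕ.* s) ℕ.^ suc j ℕ.≤ l ℕ.* a ℕ.^ j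
  [as]^[1+j]≤ {l} a s j as^r≤l = begin
    (a ℕ.* s) ℕ.^ suc j           ≡⟨ ^-distribʳ-* (suc j) a s ⟩
    a ℕ.^ suc j ℕ.* s ℕ.^ suc j     ≡⟨ regroup a (a ℕ.^ j) (s ℕ.^ suc j) ⟩
    a ℕ.* s ℕ.^ suc j ℕ.* a ℕ.^ j   ≤⟨ ℕ.*-monoˡ-≤ (a ℕ.^ j) as^r≤l ⟩
    l ℕ.* a ℕ.^ j                 ∎
    where
    open ℕ.≤-Reasoning
    regroup : ∀ x y z → x ℕ.* y ℕ.* z ≡ x ℕ.* z ℕ.* y
    regroup = solve 3 (λ x y z → x :* y :* z := x :* z :* y) refl where open ℕ-Solver

  -- From l / 4 < log n and a / 100 < log log n one gets a s / 200 below the root;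
  -- 400 = 2 · 200 leaves the slack that the strict cuts need.
  sizeBound-lower : ∀ {n r} l a s C → 2 ℕ.≤ r → 3 ℕ.≤ n → 2 ℕ.^ l ℕ.< n → 2 ℕ.^ (a ∸ 1) ℕ.≤ l → 1 ℕ.≤ l →
    a ℕ.* s ℕ.^ r ℕ.≤ l → 1 ℕ.≤ a → 1 ℕ.≤ C ℕ.* (a ℕ.* s) →
    fromℕ (2 ℕ.^ (C ℕ.* (a ℕ.* s))) ≤ᴿ sizeBound (ι (suc (C ℕ.* 400))) r n
  sizeBound-lower {n} {r@(suc (suc j))} l a s C (ℕ.s≤s (ℕ.s≤s _)) 3≤n 2^l<n 2^[a-1]≤l 1≤l as^r≤l 1≤a 1≤E =
    subst (λ E → fromℕ (2 ℕ.^ E) ≤ᴿ sizeBound c r n) suc-pred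
      (2^≤exp {fromℚ c *ᴿ root r y} (ℕ.pred E) (subst (_∈ fromℚ c *ᴿ root r y) exponent
        (*ᴿ-∈ {fromℚ c} {root r y} (0≤frac (C ℕ.* 400) 1) (0≤frac (a ℕ.* s) 400)
          (c , refl , ι-mono-< (ℕ.n<1+n (C ℕ.* 400)))
          (root-∈ {y} r (0≤frac (a ℕ.* s) 400)
            (frac-< (a ℕ.* s) 400 (a ℕ.* s) 200 (ℕ.*-monoʳ-< (a ℕ.* s) {{as≢0}} (from-yes (200 ℕ.<? 400))))
            power∈y))))
    where
    open ℕ.≤-Reasoning
    x = fromℕ n
    c = ι (suc (C ℕ.* 400))
    y = log x *ᴿ log (log x) ^ᴿ suc j
    E = C ℕ.* (a ℕ.* s)
    suc-pred : suc (ℕ.pred E) ≡ E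
    suc-pred = ℕ.suc-pred E {{ℕ.>-nonZero 1≤E}}
    as≢0 : NonZero (a ℕ.* s)
    as≢0 = ℕ.m*n≢0⇒n≢0 C {{ℕ.>-nonZero 1≤E}}
    exponent : ι (C ℕ.* 400) * frac (a ℕ.* s) 400 ≡ ι (suc (ℕ.pred E))
    exponent = trans (frac-* (C ℕ.* 400) 1 (a ℕ.* s) 400)
      (frac-≡ (C ℕ.* 400 ℕ.* (a ℕ.* s)) 400 (suc (ℕ.pred E)) 1
        (trans (swap C 400 (a ℕ.* s)) (cong (ℕ._* 400) {E} {suc (ℕ.pred E)} (sym suc-pred))))
      where
      swap : ∀ x y z → x ℕ.* y ℕ.* z ℕ.* 1 ≡ x ℕ.* z ℕ.* y
      swap = solve 3 (λ x y z → x :* y :* z :* con 1 := x :* z :* y) refl where open ℕ-Solver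
    instance
      200^[1+j]≢0 : NonZero (200 ℕ.^ suc j)
      200^[1+j]≢0 = ℕ.m^n≢0 200 (suc j)
      200^r≢0 : NonZero (200 ℕ.^ r)
      200^r≢0 = ℕ.m^n≢0 200 r
      4*200^≢0 : NonZero (4 ℕ.* 200 ℕ.^ suc j)
      4*200^≢0 = ℕ.m*n≢0 4 (200 ℕ.^ suc j)
      a≢0 : NonZero a
      a≢0 = ℕ.>-nonZero 1≤a
    product∈y : frac l 4 * frac a 200 ^ℚ suc j ∈ y
    product∈y =
      *ᴿ-∈ {log x} {log (log x) ^ᴿ suc j} (0≤frac l 4) (0≤^ (suc j) (0≤frac a 200)) (log-lower l 1≤l 2^l<n)
      (subst (λ b → b ^ℚ suc j ∈ log (log x) ^ᴿ suc j) half
        (^ᴿ-∈ {log (log x)} j (0≤frac a 100) a/100∈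
          (Real.closed (log (log x)) (subst (ℚ._< frac a 100) (sym half)
            (frac-< a 200 a 100 (ℕ.*-monoʳ-< a (from-yes (100 ℕ.<? 200))))) a/100∈)))
      where
      a/100∈ = loglog-lower l a 3≤n 2^l<n 2^[a-1]≤l
      half : frac a 100 * ½ ≡ frac a 200
      half = trans (frac-* a 100 1 2) (cong (λ b → frac b 200) (ℕ.*-identityʳ a))
    power∈y : frac (a ℕ.* s) 200 ^ℚ r ∈ y
    power∈y = Real.closed y (subst₂ ℚ._<_ (sym (frac-^ (a ℕ.* s) 200 r))
      (sym (trans (cong (frac l 4 *_) (frac-^ a 200 (suc j))) (frac-* l 4 (a ℕ.^ suc j) (200 ℕ.^ suc j))))
      (frac-< ((a ℕ.* s) ℕ.^ r) (200 ℕ.^ r) (l ℕ.* a ℕ.^ suc j) (4 ℕ.* 200 ℕ.^ suc j) (begin-strict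
        (a ℕ.* s) ℕ.^ r ℕ.* (4 ℕ.* 200 ℕ.^ suc j)     ≤⟨ ℕ.*-monoˡ-≤ (4 ℕ.* 200 ℕ.^ suc j) ([as]^[1+j]≤ a s (suc j) as^r≤l) ⟩
        l ℕ.* a ℕ.^ suc j ℕ.* (4 ℕ.* 200 ℕ.^ suc j)
          <⟨ ℕ.*-monoʳ-< (l ℕ.* a ℕ.^ suc j) {{la^≢0}} (ℕ.*-monoˡ-< (200 ℕ.^ suc j) (from-yes (4 ℕ.<? 200))) ⟩
        l ℕ.* a ℕ.^ suc j ℕ.* 200 ℕ.^ r ∎))) product∈y
      where
      la^≢0 : NonZero (l ℕ.* a ℕ.^ suc j)
      la^≢0 = ℕ.m*n≢0 l (a ℕ.^ suc j) {{ℕ.>-nonZero 1≤l}} {{ℕ.m^n≢0 a (suc j)}}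

-- Choice of parameters

two-primes : ∀ {m} → 1 < m → ¬ IsPrimePower m → (F : PrimePowerFactorisation m) → 2 ≤ PrimePowerFactorisation.r F
two-primes 1<m _  record { r = zero ; factorisation = refl } = contradiction 1<m (ℕ.<-irrefl refl)
two-primes _   ¬pp record { r = suc zero ; p = p ; e = e ; prime = prime ; positive = positive ; factorisation = m≡ } =
  contradiction (p zero , e zero , prime zero , positive zero , trans m≡ (ℕ.*-identityʳ (p zero ℕ.^ e zero))) ¬pp
two-primes _   _   record { r = suc (suc _) } = s≤s (s≤s z≤n)

-- Junk value: 0 if no x ≤ b satisfies f x ≤ y.
largest : (ℕ → ℕ) → ℕ → ℕ → ℕ
largest f y zero    = 0
largest f y (suc b) with f (suc b) ℕ.≤? y
... | yes _ = suc b
... | no  _ = largest f y b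

largest-≤ : ∀ (f : ℕ → ℕ) {y} b → f 0 ≤ y → f (largest f y b) ≤ y
largest-≤ f     zero    f0≤y = f0≤y
largest-≤ f {y} (suc b) f0≤y with f (suc b) ℕ.≤? y
... | yes fb≤y = fb≤y
... | no  _    = largest-≤ f b f0≤y

-- The search runs downward, so the value just above the result has failed its test, or it is b + 1,
-- which the hypothesis excludes.
largest-> : ∀ (f : ℕ → ℕ) {y} b → y < f (suc b) → y < f (suc (largest f y b))
largest-> f     zero    y<f1 = y<f1
largest-> f {y} (suc b) y<fb with f (suc b) ℕ.≤? y
... | yes _    = y<fb
... | no  fb≰y = largest-> f b (ℕ.≰⇒> fb≰y)

n<b^n : ∀ {b} n → 1 < b → n < b ℕ.^ n
n<b^n         zero    1<b = s≤s z≤n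
n<b^n {b} (suc n) 1<b = begin-strict
  suc n          ≤⟨ n<b^n n 1<b ⟩
  b ℕ.^ n        <⟨ ℕ.^-monoʳ-< b 1<b (ℕ.n<1+n n) ⟩
  b ℕ.^ suc n    ∎
  where open ℕ.≤-Reasoning

n≤n^k : ∀ n {k} → 1 ≤ k → n ≤ n ℕ.^ k
n≤n^k zero    1≤k = z≤n
n≤n^k (suc n) {k} 1≤k = subst (_≤ suc n ℕ.^ k) (ℕ.*-identityʳ (suc n)) (ℕ.^-monoʳ-≤ (suc n) 1≤k)

-- Words of length (1 + s)^r over an alphabet of size 2^a, with l ≈ log₂ n and a ≈ log₂ l.
record Scale (r n l a s : ℕ) : Set where
  field
    2^l<n      : 2 ℕ.^ l < n
    n≤2^[1+l]  : n ≤ 2 ℕ.^ suc l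
    1≤l        : 1 ≤ l
    2^[a-1]≤l  : 2 ℕ.^ (a ∸ 1) ≤ l
    l<2^a      : l < 2 ℕ.^ a
    1≤a        : 1 ≤ a
    as^r≤l     : a ℕ.* s ℕ.^ r ≤ l
    l<a[1+s]^r : l < a ℕ.* suc s ℕ.^ r
    1≤s        : 1 ≤ s

module _ (r : ℕ) where

  scaleˡ scaleᵃ scaleˢ : ℕ → ℕ
  -- The bound n - 1 makes 2^l < n strict, as membership in the cut of n requires.
  scaleˡ n = largest (2 ℕ.^_) (n ∸ 1) n
  scaleᵃ n = suc (largest (2 ℕ.^_) (scaleˡ n) (scaleˡ n))
  scaleˢ n = largest (λ x → scaleᵃ n ℕ.* x ℕ.^ r) (scaleˡ n) (scaleˡ n)

  scale-spec : 1 ≤ r → ∀ {n} → 3 ≤ n → Scale r n (scaleˡ n) (scaleᵃ n) (scaleˢ n)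
  scale-spec 1≤r {suc n} (s≤s 2≤n) = record
    { 2^l<n      = s≤s (largest-≤ (2 ℕ.^_) (suc n) (ℕ.<⇒≤ 2≤n))
    ; n≤2^[1+l]  = n<2^[1+l]
    ; 1≤l        = 1≤l
    ; 2^[a-1]≤l  = 2^[a-1]≤l
    ; l<2^a      = largest-> (2 ℕ.^_) l (ℕ.<-trans (n<b^n l 1<2) (ℕ.^-monoʳ-< 2 1<2 (ℕ.n<1+n l)))
    ; 1≤a        = s≤s z≤n
    ; as^r≤l     = largest-≤ f l f0≤l
    ; l<a[1+s]^r = l<f[1+s]
    -- If s were 0, then l < a, against a ≤ 2^(a-1) ≤ l.
    ; 1≤s        = ℕ.≰⇒> λ s≤0 → ℕ.<⇒≱ l<f[1+s] (begin
        f (suc s)             ≡⟨ cong (f ∘ suc) (ℕ.n≤0⇒n≡0 s≤0) ⟩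
        a ℕ.* 1 ℕ.^ r         ≡⟨ cong (a ℕ.*_) (ℕ.^-zeroˡ r) ⟩
        a ℕ.* 1               ≡⟨ ℕ.*-identityʳ a ⟩
        a                     ≤⟨ n<b^n (a ∸ 1) 1<2 ⟩
        2 ℕ.^ (a ∸ 1)         ≤⟨ 2^[a-1]≤l ⟩
        l                     ∎)
    }
    where
    open ℕ.≤-Reasoning
    l = scaleˡ (suc n)
    a = scaleᵃ (suc n)
    s = scaleˢ (suc n)
    f : ℕ → ℕ
    f x = a ℕ.* x ℕ.^ r
    1<2 : 1 < 2
    1<2 = s≤s (s≤s z≤n)
    n<2^[1+l] : n < 2 ℕ.^ suc l
    n<2^[1+l] =
      largest-> (2 ℕ.^_) (suc n) (ℕ.<-trans (n<b^n n 1<2) (ℕ.^-monoʳ-< 2 1<2 (ℕ.m<n+m n {2} (s≤s z≤n))))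
    1≤l : 1 ≤ l
    1≤l = ℕ.≰⇒> λ l≤0 → ℕ.<⇒≱ n<2^[1+l] (subst (λ x → 2 ℕ.^ suc x ≤ n) (sym (ℕ.n≤0⇒n≡0 l≤0)) 2≤n)
    2^[a-1]≤l : 2 ℕ.^ (a ∸ 1) ≤ l
    2^[a-1]≤l = largest-≤ (2 ℕ.^_) l 1≤l
    f0≤l : f 0 ≤ l
    f0≤l =
      subst (_≤ l) (sym (trans (cong (λ k → a ℕ.* 0 ℕ.^ k) (sym (ℕ.suc-pred r {{ℕ.>-nonZero 1≤r}}))) (ℕ.*-zeroʳ a))) z≤n
    l<f[1+s] : l < f (suc s)
    l<f[1+s] = largest-> f l (ℕ.≤-trans (n≤n^k (suc l) 1≤r) (ℕ.m≤n*m (suc l ℕ.^ r) a))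

product-lower : ∀ {r b} (q : Fin r → ℕ) → (∀ i → b ≤ q i) → b ℕ.^ r ≤ product q
product-lower {zero}  q b≤q = ℕ.≤-refl
product-lower {suc r} q b≤q = ℕ.*-mono-≤ (b≤q zero) (product-lower (q ∘ suc) (b≤q ∘ suc))

-- The low-rank matrix combined over all primes of m

module _ {m} (F : PrimePowerFactorisation m) where
  open PrimePowerFactorisation F

  powers-⊥ : (k : Fin r → ℕ) → PairwiseCoprime (λ i → p i ℕ.^ k i)
  powers-⊥ k i j i≢j = coprime-^ˡ (k i) (Coprimality.sym (coprime-^ˡ (k j)
    (distinct-primes⇒coprime (prime j) (prime i) λ eq → i≢j (distinct (sym eq)))))

  1<p : ∀ i → 1 < p i
  1<p i = ℕ.nonTrivial⇒n>1 (p i) {{prime⇒nonTrivial (prime i)}}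

  ε : Fin r → ℤ
  ε = idempotent component (powers-⊥ e)

  module _ (s : ℕ) where

    floorLog : Fin r → ℕ
    floorLog i = largest (p i ℕ.^_) (suc s) (suc s)

    p^x≤ : ∀ i → p i ℕ.^ floorLog i ≤ suc s
    p^x≤ i = largest-≤ (p i ℕ.^_) (suc s) (s≤s z≤n)

    p^[1+x]> : ∀ i → suc s < p i ℕ.^ suc (floorLog i)
    p^[1+x]> i =
      largest-> (p i ℕ.^_) (suc s) (ℕ.<-trans (n<b^n (suc s) (1<p i)) (ℕ.^-monoʳ-< (p i) (1<p i) (ℕ.n<1+n (suc s))))

    degree : Fin r → ℕ
    degree i = ℕ.pred (p i ℕ.^ (floorLog i ℕ.+ e i))

    suc-degree : ∀ i → suc (degree i) ≡ p i ℕ.^ (floorLog i ℕ.+ e i)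
    suc-degree i =
      ℕ.suc-pred (p i ℕ.^ (floorLog i ℕ.+ e i)) {{ℕ.m^n≢0 (p i) (floorLog i ℕ.+ e i) {{prime⇒nonZero (prime i)}}}}

    degree≤ : .{{_ : NonZero m}} → ∀ i → degree i ≤ suc s ℕ.* m
    degree≤ i = begin
      degree i                         ≤⟨ ℕ.n≤1+n (degree i) ⟩
      suc (degree i)                   ≡⟨ suc-degree i ⟩
      p i ℕ.^ (floorLog i ℕ.+ e i)            ≡⟨ ℕ.^-distribˡ-+-* (p i) (floorLog i) (e i) ⟩
      p i ℕ.^ floorLog i ℕ.* component i
        ≤⟨ ℕ.*-mono-≤ (p^x≤ i) (ℕ∣.∣⇒≤ (subst (component i ∣_) (sym factorisation) (∣-product component i))) ⟩
      suc s ℕ.* m                      ∎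
      where open ℕ.≤-Reasoning

    module _ {k : ℕ} (h : ℕ) where

      -- The idempotent confines the summand to its own prime power, and the sign `g (degree i) 0`
      -- normalises its diagonal to 1.
      summand : Fin r → Terms (Word {k} h)
      summand i = scale (ε i ℤ.* g (degree i) 0) (g-terms h (degree i))

      matrix : Terms (Word {k} h)
      matrix = ∑ᵀ summand

      eval-matrix : ∀ u v j → eval matrix u v ≅ g (degree j) 0 ℤ.* g (degree j) (dist v u) mod component j
      eval-matrix u v j =
        subst (_≅ G j mod component j) (sym expand) (sum-idempotent component (powers-⊥ e) G j)
        where
        G : Fin r → ℤ
        G i = g (degree i) 0 ℤ.* g (degree i) (dist v u)
        expand : eval matrix u v ≡ sum λ i → ε i ℤ.* G i
        expand = trans (eval-∑ᵀ summand u v) (sum-cong-≗ λ i →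
          trans (eval-scale (ε i ℤ.* g (degree i) 0) (g-terms h (degree i)) u v)
            (trans (cong (ε i ℤ.* g (degree i) 0 ℤ.*_) (eval-g-terms h (degree i) u v))
              (ℤ.*-assoc (ε i) (g (degree i) 0) (g (degree i) (dist v u)))))

      diagonal : ∀ u j → ℤ.1ℤ ≅ eval matrix u u mod component j
      diagonal u j = mod-sym {a = eval matrix u u} {ℤ.1ℤ} (subst (eval matrix u u ≅_mod component j)
        (trans (cong (λ w → g (degree j) 0 ℤ.* g (degree j) w) (dist-refl u)) (g-zero² (degree j))) (eval-matrix u u j))

      off-diagonal : h < suc (suc s) ℕ.^ r → ∀ u v → dist v u ≢ 0 → ∃[ j ] ℤ.0ℤ ≅ eval matrix u v mod component j
      off-diagonal h<[2+s]^r u v d≢0 =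
        j , mod-sym {a = eval matrix u v} {ℤ.0ℤ} (mod-trans {a = eval matrix u v} {G} {ℤ.0ℤ} (eval-matrix u v j)
        (subst (ℤ.+ component j ℤ∣.∣_) (sym (ℤ.+-identityʳ G)) (ℤ∣.∣n⇒∣m*n (g (degree j) 0)
          (p^e∣g (prime j) (floorLog j) (e j) (degree j) (dist v u) (suc-degree j) p^[1+x]∤d))))
        where
        Q : Fin r → ℕ
        Q i = p i ℕ.^ suc (floorLog i)
        Q∤ : ¬ (∀ i → Q i ∣ dist v u)
        Q∤ Q∣d = ℕ.<⇒≱ h<[2+s]^r (begin
          suc (suc s) ℕ.^ r ≤⟨ product-lower Q p^[1+x]> ⟩
          product Q         ≤⟨ ℕ∣.∣⇒≤ {{ℕ.≢-nonZero d≢0}} (product-∣ Q (powers-⊥ (suc ∘ floorLog)) Q∣d) ⟩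
          dist v u          ≤⟨ dist≤ v u ⟩
          h                 ∎)
          where open ℕ.≤-Reasoning
        witness : ∃[ i ] ¬ Q i ∣ dist v u
        -- Divisibility is decidable and there are finitely many primes, so a failing index is found
        -- by search.
        witness = Fin.¬∀⟶∃¬ r _ (λ i → Q i ℕ∣.∣? dist v u) Q∤
        j = proj₁ witness
        p^[1+x]∤d = proj₂ witness
        G = g (degree j) 0 ℤ.* g (degree j) (dist v u)

      length-matrix : .{{_ : NonZero m}} → length matrix ≤ r ℕ.* suc (h ℕ.* k) ℕ.^ (suc s ℕ.* m)
      length-matrix = length-∑ᵀ summand λ i → begin
        length (summand i)
          ≡⟨ List.length-map _ (g-terms h (degree i)) ⟩
        length (g-terms {k} h (degree i))                             ≤⟨ length-g-terms h (degree i) ⟩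
        suc (h ℕ.* k) ℕ.^ degree i
          ≤⟨ ℕ.^-monoʳ-≤ (suc (h ℕ.* k)) (degree≤ i) ⟩
        suc (h ℕ.* k) ℕ.^ (suc s ℕ.* m)                               ∎
        where open ℕ.≤-Reasoning

-- The first r pays for the r summands, as r ≤ 2^r; r + 3 comes from hk + 1 ≤ 2^((r+3)a), and 2m
-- from (s + 1) m ≤ 2 s m.
rank-exponent : ℕ → ℕ → ℕ
rank-exponent r m = r ℕ.+ (r ℕ.+ 3) ℕ.* (2 ℕ.* m)

rank-bound : ∀ {r n l a s} m → Scale r n l a s →
  r ℕ.* suc (suc s ℕ.^ r ℕ.* 2 ℕ.^ a) ℕ.^ (suc s ℕ.* m) ≤ 2 ℕ.^ (rank-exponent r m ℕ.* (a ℕ.* s))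
rank-bound {r} {n} {l} {a} {s} m sc = begin
  r ℕ.* suc (suc s ℕ.^ r ℕ.* 2 ℕ.^ a) ℕ.^ (suc s ℕ.* m)
    ≤⟨ ℕ.*-mono-≤ (ℕ.<⇒≤ (n<b^n r 1<2)) (ℕ.^-monoˡ-≤ (suc s ℕ.* m) base) ⟩
  2 ℕ.^ r ℕ.* (2 ℕ.^ b) ℕ.^ (suc s ℕ.* m)
    ≡⟨ cong (2 ℕ.^ r ℕ.*_) (ℕ.^-*-assoc 2 b (suc s ℕ.* m)) ⟩
  2 ℕ.^ r ℕ.* 2 ℕ.^ (b ℕ.* (suc s ℕ.* m))                   ≡⟨ ℕ.^-distribˡ-+-* 2 r (b ℕ.* (suc s ℕ.* m)) ⟨
  2 ℕ.^ (r ℕ.+ b ℕ.* (suc s ℕ.* m))                         ≤⟨ ℕ.^-monoʳ-≤ 2 exponent ⟩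
  2 ℕ.^ (rank-exponent r m ℕ.* (a ℕ.* s))                   ∎
  where
  open ℕ.≤-Reasoning
  open Scale sc
  b = suc (r ℕ.+ a ℕ.+ a)
  1<2 : 1 < 2
  1<2 = s≤s (s≤s z≤n)
  instance
    _ = ℕ.>-nonZero 1≤a
    _ = ℕ.>-nonZero 1≤s
    as≢0 = ℕ.m*n≢0 a s
  1+s≤2s : suc s ≤ 2 ℕ.* s
  1+s≤2s = ℕ.≤-trans (ℕ.+-monoˡ-≤ s 1≤s) (ℕ.≤-reflexive (cong (s ℕ.+_) (sym (ℕ.+-identityʳ s))))
  -- Word length and alphabet size are both 2^O(a), since s^r ≤ a s^r ≤ l < 2^a. Hence each unit of
  -- degree costs only O(a) in the exponent.
  base : suc (suc s ℕ.^ r ℕ.* 2 ℕ.^ a) ≤ 2 ℕ.^ b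
  base = begin
    suc (suc s ℕ.^ r ℕ.* 2 ℕ.^ a)               ≤⟨ s≤s (ℕ.*-monoˡ-≤ (2 ℕ.^ a) (begin
      suc s ℕ.^ r                ≤⟨ ℕ.^-monoˡ-≤ r 1+s≤2s ⟩
      (2 ℕ.* s) ℕ.^ r            ≡⟨ ^-distribʳ-* r 2 s ⟩
      2 ℕ.^ r ℕ.* s ℕ.^ r
        ≤⟨ ℕ.*-monoʳ-≤ (2 ℕ.^ r) (ℕ.≤-trans (ℕ.m≤n*m (s ℕ.^ r) a) (ℕ.≤-trans as^r≤l (ℕ.<⇒≤ l<2^a))) ⟩
      2 ℕ.^ r ℕ.* 2 ℕ.^ a        ≡⟨ ℕ.^-distribˡ-+-* 2 r a ⟨
      2 ℕ.^ (r ℕ.+ a)            ∎)) ⟩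
    suc (2 ℕ.^ (r ℕ.+ a) ℕ.* 2 ℕ.^ a)           ≡⟨ cong suc (ℕ.^-distribˡ-+-* 2 (r ℕ.+ a) a) ⟨
    suc (2 ℕ.^ (r ℕ.+ a ℕ.+ a))                 ≤⟨ ℕ.^-monoʳ-< 2 1<2 (ℕ.n<1+n (r ℕ.+ a ℕ.+ a)) ⟩
    2 ℕ.^ b                                     ∎
  b≤ : b ≤ (r ℕ.+ 3) ℕ.* a
  b≤ = begin
    suc (r ℕ.+ a ℕ.+ a)           ≤⟨ ℕ.+-mono-≤ 1≤a (ℕ.+-monoˡ-≤ a (ℕ.+-monoˡ-≤ a (ℕ.m≤m*n r a))) ⟩
    a ℕ.+ (r ℕ.* a ℕ.+ a ℕ.+ a)   ≡⟨ solve 2 (λ r a → a :+ (r :* a :+ a :+ a) := (r :+ con 3) :* a) refl r a ⟩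
    (r ℕ.+ 3) ℕ.* a               ∎
    where open ℕ-Solver
  exponent : r ℕ.+ b ℕ.* (suc s ℕ.* m) ≤ rank-exponent r m ℕ.* (a ℕ.* s)
  exponent = begin
    r ℕ.+ b ℕ.* (suc s ℕ.* m)
      ≤⟨ ℕ.+-mono-≤ (ℕ.m≤m*n r (a ℕ.* s)) (ℕ.*-mono-≤ b≤ (ℕ.*-monoˡ-≤ m 1+s≤2s)) ⟩
    r ℕ.* (a ℕ.* s) ℕ.+ (r ℕ.+ 3) ℕ.* a ℕ.* (2 ℕ.* s ℕ.* m)
      ≡⟨ solve 4 (λ r a s m → r :* (a :* s) :+ (r :+ con 3) :* a :* (con 2 :* s :* m) := (r :+ (r :+ con 3) :* (con 2 :* m)) :* (a :* s)) refl r a s m ⟩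
    rank-exponent r m ℕ.* (a ℕ.* s) ∎
    where open ℕ-Solver

-- At b = 2q + 2 this follows from q + 1 ≤ 2^q; from there on the right side doubles at each step.
linear≤2^ : ∀ q b → 2 ℕ.* q ℕ.+ 2 ≤ b → q ℕ.* suc b ≤ 2 ℕ.^ b
linear≤2^ q b b₀≤b = subst (λ b → q ℕ.* suc b ≤ 2 ℕ.^ b) (ℕ.m+[n∸m]≡n b₀≤b) (from (b ∸ b₀))
  where
  open ℕ.≤-Reasoning
  open ℕ-Solver
  b₀ = 2 ℕ.* q ℕ.+ 2
  from : ∀ c → q ℕ.* suc (b₀ ℕ.+ c) ≤ 2 ℕ.^ (b₀ ℕ.+ c)
  from zero = begin
    q ℕ.* suc (b₀ ℕ.+ 0)
      ≤⟨ ℕ.m≤m+n (q ℕ.* suc (b₀ ℕ.+ 0)) (2 ℕ.* (q ℕ.* q) ℕ.+ 5 ℕ.* q ℕ.+ 4) ⟩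
    q ℕ.* suc (b₀ ℕ.+ 0) ℕ.+ (2 ℕ.* (q ℕ.* q) ℕ.+ 5 ℕ.* q ℕ.+ 4)
      ≡⟨ solve 1 (λ q → q :* (con 1 :+ (con 2 :* q :+ con 2 :+ con 0)) :+ (con 2 :* (q :* q) :+ con 5 :* q :+ con 4)
                     := (con 1 :+ q) :* (con 1 :+ q) :* con 4) refl q ⟩
    suc q ℕ.* suc q ℕ.* 4
      ≤⟨ ℕ.*-monoˡ-≤ 4 (ℕ.*-mono-≤ (n<b^n q (s≤s (s≤s z≤n))) (n<b^n q (s≤s (s≤s z≤n)))) ⟩
    2 ℕ.^ q ℕ.* 2 ℕ.^ q ℕ.* 2 ℕ.^ 2   ≡⟨ cong (ℕ._* 4) (ℕ.^-distribˡ-+-* 2 q q) ⟨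
    2 ℕ.^ (q ℕ.+ q) ℕ.* 2 ℕ.^ 2       ≡⟨ ℕ.^-distribˡ-+-* 2 (q ℕ.+ q) 2 ⟨
    2 ℕ.^ (q ℕ.+ q ℕ.+ 2)
      ≡⟨ cong (2 ℕ.^_) (solve 1 (λ q → q :+ q :+ con 2 := con 2 :* q :+ con 2 :+ con 0) refl q) ⟩
    2 ℕ.^ (b₀ ℕ.+ 0)                  ∎
  from (suc c) = begin
    q ℕ.* suc (b₀ ℕ.+ suc c)
      ≤⟨ ℕ.m≤m+n (q ℕ.* suc (b₀ ℕ.+ suc c)) (q ℕ.* (b₀ ℕ.+ c)) ⟩
    q ℕ.* suc (b₀ ℕ.+ suc c) ℕ.+ q ℕ.* (b₀ ℕ.+ c)
      ≡⟨ solve 3 (λ q b c → q :* (con 1 :+ (b :+ (con 1 :+ c))) :+ q :* (b :+ c) := con 2 :* (q :* (con 1 :+ (b :+ c)))) refl q b₀ c ⟩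
    2 ℕ.* (q ℕ.* suc (b₀ ℕ.+ c))      ≤⟨ ℕ.*-monoʳ-≤ 2 (from c) ⟩
    2 ℕ.^ suc (b₀ ℕ.+ c)              ≡⟨ cong (2 ℕ.^_) (ℕ.+-suc b₀ c) ⟨
    2 ℕ.^ (b₀ ℕ.+ suc c)              ∎

-- If q ≤ s, one factor s absorbs q: q a s ≤ a s² ≤ a s^r ≤ l, which rests on r ≥ 2. Otherwise q a s
-- ≤ q² a, and 2^(a-1) ≤ l dominates this once a is large compared with q.
sublinear : ∀ {r n l a s} q → 2 ≤ r → Scale r n l a s → 2 ℕ.* (q ℕ.* q) ℕ.+ 2 < a → q ℕ.* (a ℕ.* s) ≤ l
sublinear {r} {n} {l} {suc b} {s} q 2≤r sc (s≤s b₀≤b) with ℕ.≤-total q s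
... | inj₁ q≤s = begin
  q ℕ.* (a ℕ.* s)      ≤⟨ ℕ.*-monoˡ-≤ (a ℕ.* s) q≤s ⟩
  s ℕ.* (a ℕ.* s)      ≡⟨ solve 2 (λ a s → s :* (a :* s) := a :* (s :* (s :* con 1))) refl a s ⟩
  a ℕ.* s ℕ.^ 2        ≤⟨ ℕ.*-monoʳ-≤ a (ℕ.^-monoʳ-≤ s {{ℕ.>-nonZero 1≤s}} 2≤r) ⟩
  a ℕ.* s ℕ.^ r        ≤⟨ as^r≤l ⟩
  l                    ∎
  where
  open Scale sc
  open ℕ.≤-Reasoning
  open ℕ-Solver
  a = suc b
... | inj₂ s≤q = begin
  q ℕ.* (a ℕ.* s)      ≤⟨ ℕ.*-monoʳ-≤ q (ℕ.*-monoʳ-≤ a s≤q) ⟩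
  q ℕ.* (a ℕ.* q)      ≡⟨ solve 2 (λ a q → q :* (a :* q) := q :* q :* a) refl a q ⟩
  q ℕ.* q ℕ.* a        ≤⟨ linear≤2^ (q ℕ.* q) b b₀≤b ⟩
  2 ℕ.^ b              ≤⟨ 2^[a-1]≤l ⟩
  l                    ∎
  where
  open Scale sc
  open ℕ.≤-Reasoning
  open ℕ-Solver
  a = suc b

rank : ℕ → ℕ → ℕ → ℕ
rank r C n = 2 ℕ.^ (C ℕ.* (scaleᵃ r n ℕ.* scaleˢ r n))

-- The k-th power merely multiplies C by k in the exponent. The threshold is doubly exponential
-- because a, about log₂ log₂ n, has to exceed `b₀`. The lower bound holds because powers of 2 are
-- positive.
rank-subpolynomial : ∀ r C → 2 ≤ r → IsSubpolynomial (rank r C)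
rank-subpolynomial r C 2≤r k _ = 3 ℕ.+ 2 ℕ.^ 2 ℕ.^ b₀ , λ n n₀≤n →
  upper (scale-spec r (ℕ.<⇒≤ 2≤r) (ℕ.≤-trans (ℕ.m≤m+n 3 (2 ℕ.^ 2 ℕ.^ b₀)) n₀≤n)) n₀≤n ,
  ℕ.≤-trans (ℕ.≤-trans (s≤s z≤n) n₀≤n) (ℕ.m≤m*n n (rank r C n ℕ.^ k) {{ℕ.m^n≢0 (rank r C n) k {{ℕ.m^n≢0 2 (C ℕ.* (scaleᵃ r n ℕ.* scaleˢ r n))}}}})
  where
  open ℕ.≤-Reasoning
  q = C ℕ.* k
  b₀ = 2 ℕ.* (q ℕ.* q) ℕ.+ 2
  upper : ∀ {n l a s} → Scale r n l a s → 3 ℕ.+ 2 ℕ.^ 2 ℕ.^ b₀ ≤ n → (2 ℕ.^ (C ℕ.* (a ℕ.* s))) ℕ.^ k ≤ n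
  upper {n} {l} {a} {s} sc n₀≤n = begin
    (2 ℕ.^ (C ℕ.* (a ℕ.* s))) ℕ.^ k    ≡⟨ ℕ.^-*-assoc 2 (C ℕ.* (a ℕ.* s)) k ⟩
    2 ℕ.^ (C ℕ.* (a ℕ.* s) ℕ.* k)
      ≡⟨ cong (2 ℕ.^_) (solve 3 (λ C x k → C :* x :* k := C :* k :* x) refl C (a ℕ.* s) k) ⟩
    2 ℕ.^ (q ℕ.* (a ℕ.* s))            ≤⟨ ℕ.^-monoʳ-≤ 2 (sublinear q 2≤r sc b₀<a) ⟩
    2 ℕ.^ l                            ≤⟨ ℕ.<⇒≤ 2^l<n ⟩
    n                                  ∎
    where
    open Scale sc
    open ℕ-Solver
    b₀<a : b₀ < a
    b₀<a = ℕ.≰⇒> λ a≤b₀ → ℕ.<⇒≱ (ℕ.<-≤-trans (ℕ.m<n+m (2 ℕ.^ 2 ℕ.^ b₀) {3} (s≤s z≤n)) n₀≤n) (begin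
      n                  ≤⟨ n≤2^[1+l] ⟩
      2 ℕ.^ suc l        ≤⟨ ℕ.^-monoʳ-≤ 2 l<2^a ⟩
      2 ℕ.^ 2 ℕ.^ a      ≤⟨ ℕ.^-monoʳ-≤ 2 (ℕ.^-monoʳ-≤ 2 a≤b₀) ⟩
      2 ℕ.^ 2 ℕ.^ b₀     ∎)

module _ (m : ℕ) (1<m : 1 < m) (¬pp : ¬ IsPrimePower m) (F : PrimePowerFactorisation m) where
  open PrimePowerFactorisation F using (r)
  open Polynomials (ℤ/ m)
  open Representations F

  private
    2≤r = two-primes 1<m ¬pp F
    1≤r = ℕ.<⇒≤ 2≤r
    C₀ = rank-exponent r m

  strong-factorisation : ∀ {n l a s} → Scale r n l a s → (t : ℕ) → t ≡ 2 ℕ.^ (C₀ ℕ.* (a ℕ.* s)) →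
    Σ[ B ∈ Matrix ℤ n t ] Σ[ C ∈ Matrix ℤ n t ]
      let X = indeterminates n
          _·_ = matMul (polynomials _)
          XBCᵀ = (X · constᴹ B) · (constᴹ C ᵀ)
      in Is1-a-StrongMatrixRep XBCᵀ X × ColumnsAreCombinationsOf XBCᵀ X
  strong-factorisation {n} {l} {a} {s} sc t refl = B , C ,
    strong-representation F B C (fromℕ< 1≤r)
      (λ j k → subst (ℤ.1ℤ ≅_mod component k) (sym (BCᵀ j j)) (diagonal F s h (W j) k))
      (λ l j l≢j → let (k , A≅0) = off-diagonal F s h h<[2+s]^r (W l) (W j) (λ d≡0 → l≢j (word-injective h n≤k^h (λ i → sym (dist≡0⇒≗ d≡0 i)))) in
        k , subst (ℤ.0ℤ ≅_mod component k) (sym (BCᵀ l j)) A≅0) ,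
    columns-combine m (indeterminates n) B C
    where
    open Scale sc
    open PrimePowerFactorisation F using (component)
    open ℕ.≤-Reasoning
    h = suc s ℕ.^ r
    instance
      _ = ℕ.>-nonZero (ℕ.<⇒≤ 1<m)
    h<[2+s]^r : h < suc (suc s) ℕ.^ r
    h<[2+s]^r = ℕ.^-monoˡ-< r {{ℕ.>-nonZero 1≤r}} (ℕ.n<1+n (suc s))
    -- Maximality of s, that is l < a (1 + s)^r, guarantees enough words to label the rows.
    n≤k^h : n ≤ (2 ℕ.^ a) ℕ.^ h
    n≤k^h = begin
      n                   ≤⟨ n≤2^[1+l] ⟩
      2 ℕ.^ suc l         ≤⟨ ℕ.^-monoʳ-≤ 2 l<a[1+s]^r ⟩
      2 ℕ.^ (a ℕ.* h)     ≡⟨ ℕ.^-*-assoc 2 a h ⟨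
      (2 ℕ.^ a) ℕ.^ h     ∎
    W : Fin n → Word h
    W = word h n≤k^h
    M : Terms (Word {2 ℕ.^ a} h)
    M = matrix F s h
    B C : Matrix ℤ n t
    B i k = proj₁ (factor M t k) (W i)
    C i k = proj₂ (factor M t k) (W i)
    BCᵀ : ∀ i j → (sum λ k → B i k ℤ.* C j k) ≡ eval M (W i) (W j)
    BCᵀ i j = sum-factor M t (ℕ.≤-trans (length-matrix F s h) (rank-bound m sc)) (W i) (W j)

theorem8 : (m : ℕ) → 1 < m → ¬ IsPrimePower m → (F : PrimePowerFactorisation m) →
  let open PrimePowerFactorisation F using (r)
      open Polynomials (ℤ/ m)
      open Representations F
  in
  Σ[ c ∈ ℚ ] 0ℚ ℚ.< c × (Σ[ t ∈ (ℕ → ℕ) ] IsSubpolynomial t ×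
    ((n : ℕ) → 3 ≤ n →
      fromℕ (t n) ≤ᴿ sizeBound c r n ×
      (Σ[ B ∈ Matrix ℤ n (t n) ] Σ[ C ∈ Matrix ℤ n (t n) ]
        let X = indeterminates n
            _·_ = matMul (polynomials _)
            XBCᵀ = (X · constᴹ B) · (constᴹ C ᵀ)
        in Is1-a-StrongMatrixRep XBCᵀ X × ColumnsAreCombinationsOf XBCᵀ X)))
theorem8 m 1<m ¬pp F =
  -- The successor puts 400 `C₀` strictly below c, hence into its cut.
  ι (suc (C₀ ℕ.* 400)) , ι-mono-< {0} {suc (C₀ ℕ.* 400)} (s≤s z≤n) , rank r C₀ , rank-subpolynomial r C₀ 2≤r , λ n 3≤n →
    let sc = scale-spec r 1≤r 3≤n
        open Scale sc
    in sizeBound-lower {n} {r} (scaleˡ r n) (scaleᵃ r n) (scaleˢ r n) C₀ 2≤r 3≤n 2^l<n 2^[a-1]≤l 1≤l as^r≤l 1≤a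
         (ℕ.*-mono-≤ {1} {C₀} (ℕ.≤-trans 1≤r (ℕ.m≤m+n r _)) (ℕ.*-mono-≤ 1≤a 1≤s)) ,
       strong-factorisation m 1<m ¬pp F sc (rank r C₀ n) refl
  where
  open PrimePowerFactorisation F using (r)
  2≤r = two-primes 1<m ¬pp F
  1≤r = ℕ.<⇒≤ 2≤r
  C₀ = rank-exponent r m
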